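{- Biased Dissolution restricted to instances whose graph $G=(V,E)$ is a complete graph is solvable in $O(|V|^2)$ time (assuming constant-time arithmetic operations).
   Context: For $V'\subseteq V(G)$ let $Z(V',G):=\{(x,y)\mid x\in V',\ y\in V(G)\setminus V',\ \{x,y\}\in E(G)\}$. For positive integers $s,\Delta_s$, an $(s,\Delta_s)$-dissolution for an undirected graph $G$ is a pair $(D,z)$ with $D\subset V(G)$ and $z\colon Z(D,G)\to\{0,\dots,s\}$ such that (a) each $v'\in D$ satisfies $\sum_{(v',v)\in Z(D,G)} z(v',v)=s$, and (b) each $v\in V(G)\setminus D$ satisfies $\sum_{(v',v)\in Z(D,G)} z(v',v)=\Delta_s$. Given $\alpha\colon V(G)\to\{0,\dots,s\}$ and an integer $r_\alpha$, a tuple $(D,z,z_\alpha,R_\alpha)$ is an $r_\alpha$-biased $(s,\Delta_s)$-dissolution for $(G,\alpha)$ if $(D,z)$ is an $(s,\Delta_s)$-dissolution, $z_\alpha\colon Z(D,G)\to\{0,\dots,s\}$, $R_\alpha\subseteq V(G)\setminus D$ with $|R_\alpha|=r_\alpha$, and (c) $z_\alpha(v',v)\le z(v',v)$ for all $(v',v)\in Z(D,G)$; (d) each $v'\in D$ satisfies $\sum_{(v',v)\in Z(D,G)} z_\alpha(v',v)=\alpha(v')$; (e) each $v\in R_\alpha$ satisfies $\alpha(v)+\sum_{(v',v)\in Z(D,G)} z_\alpha(v',v)>(s+\Delta_s)/2$. Biased Dissolution: given an undirected graph $G$, positive integers $s,\Delta_s,r_\alpha$ and $\alpha\colon V(G)\to\{0,\dots,s\}$,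 decide whether an $r_\alpha$-biased $(s,\Delta_s)$-dissolution for $(G,\alpha)$ exists. -}

module Defs where

open import Algebra.Properties.CommutativeMonoid.Sum using (sum)
open import Data.Bool using (Bool; false; T; if_then_else_)
open import Data.Bool.Properties using (T?)
open import Data.Fin using (Fin; toℕ)
open import Data.Fin.Subset using (Subset; _∈_; _∉_; _⊆_; _⊂_; ∁; ⊤; ∣_∣)
open import Data.Fin.Subset.Properties using (_∈?_)
open import Data.List using (List; []; _∷_; _++_; concat; tabulate)
open import Data.Nat using (ℕ; zero; suc; _+_; _*_; _∸_; _/_; _≤_; _<_; _≟_)
open import Data.Nat.Properties using (+-0-commutativeMonoid)
open import Data.Product using (∃-syntax; ∃₂; _×_; _,_)
open import Data.Sum using (_⊎_)
open import Function using (_∘_)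
open import Relation.Binary.PropositionalEquality using (_≡_; _≢_; refl)
open import Relation.Nullary using (Dec; yes; no; ¬_; does; contradiction)
open import Relation.Nullary.Decidable using (¬?; _×-dec_)

record Graph (n : ℕ) : Set where
  field
    adj       : Fin n → Fin n → Bool
    symmetric : ∀ u v → adj u v ≡ adj v u
    loopless  : ∀ v → adj v v ≡ false

  Adj : Fin n → Fin n → Set
  Adj u v = T (adj u v)

open Graph public using (adj; Adj)

Complete : ∀ {n} → Graph n → Set
Complete G = ∀ u v → u ≢ v → Adj G u v

∑ : ∀ {n} → (Fin n → ℕ) → ℕ
∑ = sum +-0-commutativeMonoid

InZ : ∀ {n} → Subset n → Graph n → Fin n → Fin n → Set
InZ D G x y = x ∈ D × y ∉ D × Adj G x y

inZ? : ∀ {n} (D : Subset n) (G : Graph n) x y → Dec (InZ D G x y)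
inZ? D G x y = x ∈? D ×-dec (¬? (y ∈? D) ×-dec T? (adj G x y))

Z : ∀ {n} → Subset n → Graph n → Set
Z D G = ∃₂ λ x y → InZ D G x y

module _ {n s : ℕ} (G : Graph n) (D : Subset n) (z : Z D G → Fin (suc s)) where

  -- Extension of z by zero to all pairs of vertices, so that sums over the
  -- pairs in Z(D,G) with one entry fixed become sums over all vertices.
  extend : Fin n → Fin n → ℕ
  extend x y with inZ? D G x y
  ... | yes xy∈Z = toℕ (z (x , y , xy∈Z))
  ... | no  _    = 0

  outflow : Fin n → ℕ
  outflow v′ = ∑ λ v → extend v′ v

  inflow : Fin n → ℕ
  inflow v = ∑ λ v′ → extend v′ v

record IsDissolution {n} (s Δ : ℕ) (G : Graph n)
                     (D : Subset n) (z : Z D G → Fin (suc s)) : Set where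
  field
    proper    : D ⊂ ⊤
    dissolved : ∀ v′ → v′ ∈ D → outflow G D z v′ ≡ s
    remaining : ∀ v → v ∉ D → inflow G D z v ≡ Δ

record BiasedDissolution {n} (s Δ r : ℕ) (G : Graph n)
                         (α : Fin n → Fin (suc s)) : Set where
  field
    D             : Subset n
    z             : Z D G → Fin (suc s)
    zα            : Z D G → Fin (suc s)
    Rα            : Subset n
    isDissolution : IsDissolution s Δ G D z
    Rα⊆V∖D        : Rα ⊆ ∁ D
    ∣Rα∣≡r        : ∣ Rα ∣ ≡ r
    bounded       : ∀ e → toℕ (zα e) ≤ toℕ (z e)
    supporters    : ∀ v′ → v′ ∈ D → outflow G D zα v′ ≡ toℕ (α v′)
    -- α(v) + inflow > (s + Δ) / 2, with the denominator cleared
    majority      : ∀ v → v ∈ Rα → s + Δ < 2 * (toℕ (α v) + inflow G D zα v)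

record Instance : Set where
  field
    n     : ℕ
    graph : Graph n
    s Δ r : ℕ
    s>0   : 0 < s
    Δ>0   : 0 < Δ
    r>0   : 0 < r
    α     : Fin n → Fin (suc s)

YesInstance : Instance → Set
YesInstance I = BiasedDissolution s Δ r graph α
  where open Instance I

encode : Instance → List ℕ
encode I = n ∷ s ∷ Δ ∷ r ∷ tabulate (toℕ ∘ α)
           ++ concat (tabulate λ u → tabulate λ v → if adj graph u v then 1 else 0)
  where open Instance I

-- A random access machine with constant-time arithmetic.  Programs are
-- structured; registers are named by constants, whereas memory cells may be
-- addressed by computed values.  Subtraction is truncated and division by zero
-- yields zero.

data Op : Set where
  add monus mul div : Op

⟦_⟧ : Op → ℕ → ℕ → ℕ
⟦ add   ⟧ a b       = a + b
⟦ monus ⟧ a b       = a ∸ b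
⟦ mul   ⟧ a b       = a * b
⟦ div   ⟧ a zero    = 0
⟦ div   ⟧ a (suc b) = a / suc b

data Expr : Set where
  lit  : ℕ → Expr
  reg  : ℕ → Expr
  mem  : Expr → Expr
  op   : Op → Expr → Expr → Expr

data Program : Set where
  _:=_            : ℕ → Expr → Program
  [_]:=_          : Expr → Expr → Program
  _⨾_             : Program → Program → Program
  ifNZ_then_else_ : Expr → Program → Program → Program
  whileNZ_loop_   : Expr → Program → Program

infixr 5 _⨾_
infix  6 _:=_ [_]:=_

record State : Set where
  constructor ⟪_,_⟫
  field
    regs  : ℕ → ℕ
    cells : ℕ → ℕ

open State public

_[_↦_] : (ℕ → ℕ) → ℕ → ℕ → (ℕ → ℕ)
(f [ i ↦ x ]) j = if does (i ≟ j) then x else f j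

eval : Expr → State → ℕ
eval (lit k)    σ = k
eval (reg i)    σ = regs σ i
eval (mem a)    σ = cells σ (eval a σ)
eval (op f a b) σ = ⟦ f ⟧ (eval a σ) (eval b σ)

cost : Expr → ℕ
cost (lit k)    = 1
cost (reg i)    = 1
cost (mem a)    = 1 + cost a
cost (op f a b) = 1 + (cost a + cost b)

-- t counts evaluated expression nodes, assignments and guard tests.
data ⟨_,_⟩⇓[_]_ : Program → State → ℕ → State → Set where

  set-reg : ∀ {i e σ} →
    ⟨ i := e , σ ⟩⇓[ 1 + cost e ] ⟪ regs σ [ i ↦ eval e σ ] , cells σ ⟫

  set-mem : ∀ {a e σ} →
    ⟨ [ a ]:= e , σ ⟩⇓[ 1 + (cost a + cost e) ]
      ⟪ regs σ , cells σ [ eval a σ ↦ eval e σ ] ⟫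

  seq : ∀ {P Q σ τ υ t u} →
    ⟨ P , σ ⟩⇓[ t ] τ → ⟨ Q , τ ⟩⇓[ u ] υ →
    ⟨ P ⨾ Q , σ ⟩⇓[ t + u ] υ

  if-nonzero : ∀ {e P Q σ τ t} → eval e σ ≢ 0 →
    ⟨ P , σ ⟩⇓[ t ] τ →
    ⟨ ifNZ e then P else Q , σ ⟩⇓[ 1 + (cost e + t) ] τ

  if-zero : ∀ {e P Q σ τ t} → eval e σ ≡ 0 →
    ⟨ Q , σ ⟩⇓[ t ] τ →
    ⟨ ifNZ e then P else Q , σ ⟩⇓[ 1 + (cost e + t) ] τ

  while-nonzero : ∀ {e P σ τ υ t u} → eval e σ ≢ 0 →
    ⟨ P , σ ⟩⇓[ t ] τ → ⟨ whileNZ e loop P , τ ⟩⇓[ u ] υ →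
    ⟨ whileNZ e loop P , σ ⟩⇓[ 1 + (cost e + (t + u)) ] υ

  while-zero : ∀ {e P σ} → eval e σ ≡ 0 →
    ⟨ whileNZ e loop P , σ ⟩⇓[ 1 + cost e ] σ

-- A program has at most one terminating run from each state, so asserting the
-- existence of a run with some property is asserting it of the run.
⇓-deterministic : ∀ {P σ τ τ′ t t′} →
  ⟨ P , σ ⟩⇓[ t ] τ → ⟨ P , σ ⟩⇓[ t′ ] τ′ → t ≡ t′ × τ ≡ τ′
⇓-deterministic set-reg set-reg = refl , refl
⇓-deterministic set-mem set-mem = refl , refl
⇓-deterministic (seq p q) (seq p′ q′) with ⇓-deterministic p p′
... | refl , refl with ⇓-deterministic q q′
... | refl , refl = refl , refl
⇓-deterministic (if-nonzero _ p) (if-nonzero _ p′) with ⇓-deterministic p p′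
... | refl , refl = refl , refl
⇓-deterministic (if-nonzero ≢0 _) (if-zero ≡0 _) = contradiction ≡0 ≢0
⇓-deterministic (if-zero ≡0 _) (if-nonzero ≢0 _) = contradiction ≡0 ≢0
⇓-deterministic (if-zero _ p) (if-zero _ p′) with ⇓-deterministic p p′
... | refl , refl = refl , refl
⇓-deterministic (while-nonzero _ p q) (while-nonzero _ p′ q′) with ⇓-deterministic p p′
... | refl , refl with ⇓-deterministic q q′
... | refl , refl = refl , refl
⇓-deterministic (while-nonzero ≢0 _ _) (while-zero ≡0) = contradiction ≡0 ≢0
⇓-deterministic (while-zero ≡0) (while-nonzero ≢0 _ _) = contradiction ≡0 ≢0
⇓-deterministic (while-zero _) (while-zero _) = refl , refl

load : List ℕ → ℕ → ℕ
load []       _       = 0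
load (x ∷ xs) zero    = x
load (x ∷ xs) (suc i) = load xs i

initial : List ℕ → State
initial xs = ⟪ (λ _ → 0) , load xs ⟫

Answers : State → Set → Set
Answers τ A = (regs τ 0 ≡ 1 × A) ⊎ (regs τ 0 ≡ 0 × ¬ A)

DecidesWithin : ℕ → Program → List ℕ → Set → Set
DecidesWithin b P xs A =
  ∃[ t ] ∃[ τ ] ⟨ P , initial xs ⟩⇓[ t ] τ × t ≤ b × Answers τ A

-- The problem Q, restricted to the instances satisfying C, is solvable in time
-- O(f).  The additive constant is absorbed by c * f I unless f I = 0.
SolvableInTimeO : (f : Instance → ℕ) (Q C : Instance → Set) → Set
SolvableInTimeO f Q C =
  ∃[ P ] ∃[ c ] ((I : Instance) → C I → DecidesWithin (c * f I + c) P (encode I) (Q I))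

{-# OPTIONS --safe #-}

-- On a complete graph any supply of supporters can be distributed over V ∖ D subject
-- only to marginals (a transportation problem), so only the choice of D and R
-- matters, where |D| = d is forced by d (s + Δ) = n Δ.  Put T = ⌊(s + Δ) / 2⌋ + 1,
-- gap v = max(T − α v, 0) and surplus v = max(α v − T, 0).  A vertex of R must receive
-- gap v ≤ Δ supporters (it is eligible), and the total received is ∑_D α.
--
-- Since α + gap = T + surplus, the supporters of D cover the gaps of R iff
-- ∑_{D ∪ R} gap ≤ d T + ∑_D surplus.  The left side is least when D ∪ R consists of
-- the r + d vertices with largest α.  Ineligible vertices have surplus 0 and r of
-- the e eligible ones lie in R, so ∑_D surplus is at most the total surplus of the
-- m = min (e − r) d vertices with largest α.  One pair attains both optima: R takes
-- the ranks from m to m + r, and D the other ranks below r + d.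
--
-- The rank of v is the number of vertices preceding it, so the resulting test is
-- an arithmetic expression with sums over the vertices nested to depth two, and its
-- evaluation takes quadratic time.

module Submission where

open import Algebra.Properties.CommutativeMonoid.Sum
  using (sum-cong-≗; ∑-distrib-+; ∑-comm; sum-replicate-zero; sum-permute)
open import Algebra.Properties.CommutativeSemigroup using (x∙yz≈y∙xz)
open import Algebra.Properties.Semiring.Sum using (*-distribʳ-sum)
open import Data.Bool using (true; false; if_then_else_)
open import Data.Fin using (Fin; zero; suc; toℕ; fromℕ<; punchOut)
open import Data.Fin.Permutation using (Permutation; permutation)
import Data.Fin.Properties as Fin
open import Data.Fin.Subset using (Subset; _∈_; _∉_; ∣_∣)
open import Data.Fin.Subset.Properties using (_∈?_; ∈⊤; x∈p⇒x∉∁p; x∉p⇒x∈∁p)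
import Data.List as List
open import Data.Nat
  using (ℕ; zero; suc; _+_; _*_; _∸_; _/_; _%_; _⊔_; _⊓_; _≤_; _<_; z≤n; s≤s;
         _≤?_; _<?_; _≟_; NonZero)
open import Data.Nat using (_^_)
open import Data.Nat.DivMod using (m<n*o⇒m/o<n; m≡m%n+[m/n]*n; m%n<n; m*n/n≡m)
open import Data.Nat.Properties hiding (_≤?_; _<?_; _≟_)
open import Data.Nat.Tactic.RingSolver using (solve-∀)
open import Data.Product using (∃; ∃-syntax; _×_; _,_; proj₁; proj₂)
open import Data.Sum using (_⊎_; inj₁; inj₂; map)
open import Data.Vec using ([]; _∷_; lookup; tabulate)
open import Data.Vec.Functional as Vector using (Vector)
open import Data.Vec.Properties using ([]=⇒lookup; lookup⇒[]=; lookup∘tabulate)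
open import Function using (_∘_)
open import Relation.Binary.PropositionalEquality
open import Relation.Nullary using (Dec; yes; no; ¬_; does; contradiction)
open import Relation.Nullary.Decidable using (_×-dec_; _⊎-dec_; dec-true; dec-false)
open import Relation.Unary using (Pred; Decidable)
open import Defs

private variable
  n k : ℕ

-- Finite sums

∑-cong : {f g : Fin n → ℕ} → (∀ i → f i ≡ g i) → ∑ f ≡ ∑ g
∑-cong = sum-cong-≗ +-0-commutativeMonoid

∑-+ : (f g : Fin n → ℕ) → ∑ (λ i → f i + g i) ≡ ∑ f + ∑ g
∑-+ = ∑-distrib-+ +-0-commutativeMonoid

∑-swap : ∀ {k} (f : Fin n → Fin k → ℕ) →
  ∑ (λ i → ∑ (f i)) ≡ ∑ (λ j → ∑ (λ i → f i j))
∑-swap = ∑-comm +-0-commutativeMonoid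

∑-* : ∀ c (f : Fin n → ℕ) → ∑ (λ i → f i * c) ≡ ∑ f * c
∑-* c f = sym (*-distribʳ-sum +-*-semiring c f)

∑-const : ∀ n c → ∑ {n} (λ _ → c) ≡ n * c
∑-const zero    c = refl
∑-const (suc n) c = cong (c +_) (∑-const n c)

∑-zero : {f : Fin n → ℕ} → (∀ i → f i ≡ 0) → ∑ f ≡ 0
∑-zero {n} f≡0 = trans (∑-cong f≡0) (sum-replicate-zero +-0-commutativeMonoid n)

∑-mono : {f g : Fin n → ℕ} → (∀ i → f i ≤ g i) → ∑ f ≤ ∑ g
∑-mono {zero}  f≤g = z≤n
∑-mono {suc n} f≤g = +-mono-≤ (f≤g zero) (∑-mono (f≤g ∘ suc))

∑-mono-< : {f g : Fin n → ℕ} → (∀ i → f i ≤ g i) → ∀ i → f i < g i → ∑ f < ∑ g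
∑-mono-< f≤g zero    fi<gi = +-mono-<-≤ fi<gi (∑-mono (f≤g ∘ suc))
∑-mono-< f≤g (suc i) fi<gi = +-mono-≤-< (f≤g zero) (∑-mono-< (f≤g ∘ suc) i fi<gi)

term≤∑ : ∀ (f : Fin n → ℕ) i → f i ≤ ∑ f
term≤∑ f zero    = m≤m+n _ _
term≤∑ f (suc i) = ≤-trans (term≤∑ (f ∘ suc) i) (m≤n+m _ _)

∑≡0⇒≡0 : ∀ (f : Fin n → ℕ) → ∑ f ≡ 0 → ∀ i → f i ≡ 0
∑≡0⇒≡0 f ∑f≡0 i = n≤0⇒n≡0 (subst (f i ≤_) ∑f≡0 (term≤∑ f i))

supremum : ∀ (f : Fin n → ℕ) →
  ∃[ θ ] (∀ i → f i ≤ θ) × (∀ b → (∀ i → f i ≤ b) → θ ≤ b)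
supremum {zero}  f = 0 , (λ ()) , λ _ _ → z≤n
supremum {suc n} f with supremum (f ∘ suc)
... | θ , f≤θ , least = f zero ⊔ θ
    , (λ { zero → m≤m⊔n _ _ ; (suc i) → ≤-trans (f≤θ i) (m≤n⊔m _ _) })
    , λ b f≤b → ⊔-lub (f≤b zero) (least b (f≤b ∘ suc))

-- Built from truncated subtraction alone, so that the machine term `_≤#_` evaluates to it
-- definitionally.
𝟙[_≤_] : ℕ → ℕ → ℕ
𝟙[ a ≤ b ] = 1 ∸ (a ∸ b)

𝟙-yes : ∀ a b → a ≤ b → 𝟙[ a ≤ b ] ≡ 1
𝟙-yes a b a≤b = cong (1 ∸_) (m≤n⇒m∸n≡0 a≤b)

𝟙-no : ∀ a b → b < a → 𝟙[ a ≤ b ] ≡ 0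
𝟙-no a b b<a = m≤n⇒m∸n≡0 (m<n⇒0<n∸m b<a)

𝟙≤1 : ∀ a b → 𝟙[ a ≤ b ] ≤ 1
𝟙≤1 a b = m∸n≤m 1 (a ∸ b)

𝟙-anti : ∀ {a b} c → a ≤ b → 𝟙[ b ≤ c ] ≤ 𝟙[ a ≤ c ]
𝟙-anti c a≤b = ∸-monoʳ-≤ 1 (∸-monoˡ-≤ c a≤b)

∑-initial : ∀ {n k} → k ≤ n → ∑ {n} (λ i → 𝟙[ suc (toℕ i) ≤ k ]) ≡ k
∑-initial {n}     {zero}  _         = ∑-zero {n} λ i → 𝟙-no (suc (toℕ i)) 0 (s≤s z≤n)
∑-initial {suc n} {suc k} (s≤s k≤n) = cong₂ _+_ (𝟙-yes 1 (suc k) (s≤s z≤n)) (∑-initial k≤n)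

-- If `j` were missed, `punchOut` would turn `f` into an injection from a finite set into a smaller
-- one.
injective⇒surjective : (f : Fin n → Fin n) → (∀ {i j} → f i ≡ f j → i ≡ j) →
  ∀ j → ∃[ i ] f i ≡ j
injective⇒surjective {suc n} f inj j with Fin.any? (λ i → f i Fin.≟ j)
... | yes i = i
... | no ¬i = contradiction
        (Fin.injective⇒≤ {f = λ i → punchOut (j≢f i)}
           λ {i} {k} eq → inj (Fin.punchOut-injective (j≢f i) (j≢f k) eq))
        (<⇒≱ (n<1+n n))
  where
  j≢f : ∀ i → j ≢ f i
  j≢f i j≡fi = ¬i (i , sym j≡fi)

-- Ranking by a key

module Ranking (key : Fin n → ℕ) (key-injective : ∀ {u v} → key u ≡ key v → u ≡ v) where

  rank : Fin n → ℕ
  rank v = ∑ λ u → 𝟙[ suc (key v) ≤ key u ]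

  -- Whatever precedes `v` also precedes `u`, and `v` itself precedes `u` but not itself.
  rank-anti : ∀ {u v} → key u < key v → rank v < rank u
  rank-anti {u} {v} ku<kv = ∑-mono-<
    (λ w → 𝟙-anti (key w) (s≤s (<⇒≤ ku<kv))) v
    (subst₂ _<_ (sym (𝟙-no (suc (key v)) (key v) (n<1+n (key v))))
      (sym (𝟙-yes (suc (key u)) (key v) ku<kv)) (n<1+n 0))

  rank<n : ∀ v → rank v < n
  rank<n v = subst (rank v <_) (trans (∑-const n 1) (*-identityʳ n))
    (∑-mono-< (λ u → 𝟙≤1 (suc (key v)) (key u)) v
      (subst (_< 1) (sym (𝟙-no (suc (key v)) (key v) (n<1+n (key v)))) (n<1+n 0)))

  rank-≤⇒key-≥ : ∀ {u v} → rank u ≤ rank v → key v ≤ key u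
  rank-≤⇒key-≥ ru≤rv = ≮⇒≥ λ ku<kv → <⇒≱ (rank-anti ku<kv) ru≤rv

  rankᶠ : Fin n → Fin n
  rankᶠ v = fromℕ< (rank<n v)

  rankᶠ-injective : ∀ {u v} → rankᶠ u ≡ rankᶠ v → u ≡ v
  rankᶠ-injective {u} {v} eq = key-injective
    (≤-antisym (rank-≤⇒key-≥ (≤-reflexive (sym ru≡rv))) (rank-≤⇒key-≥ (≤-reflexive ru≡rv)))
    where
    ru≡rv : rank u ≡ rank v
    ru≡rv = Fin.fromℕ<-injective _ _ (rank<n u) (rank<n v) eq

  rank-permutation : Permutation n n
  rank-permutation = permutation rankᶠ (proj₁ ∘ surj) (proj₂ ∘ surj)
    λ v → rankᶠ-injective (proj₂ (surj (rankᶠ v)))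
    where surj = injective⇒surjective rankᶠ rankᶠ-injective

  top : ℕ → Fin n → ℕ
  top k v = 𝟙[ suc (rank v) ≤ k ]

  ∑-top : ∀ {k} → k ≤ n → ∑ (top k) ≡ k
  ∑-top {k} k≤n = begin
    ∑ (top k)
      ≡⟨ ∑-cong (λ v → cong (λ ρ → 𝟙[ suc ρ ≤ k ]) (sym (Fin.toℕ-fromℕ< (rank<n v)))) ⟩
    ∑ (λ v → 𝟙[ suc (toℕ (rankᶠ v)) ≤ k ])
      ≡⟨ sum-permute +-0-commutativeMonoid (λ i → 𝟙[ suc (toℕ i) ≤ k ]) rank-permutation ⟨
    ∑ {n} (λ i → 𝟙[ suc (toℕ i) ≤ k ])
      ≡⟨ ∑-initial k≤n ⟩
    k ∎
    where open ≡-Reasoning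

  module _ (a : Fin n → ℕ) (a-mono : ∀ {u v} → key u ≤ key v → a u ≤ a v) where

    -- The witness is the largest value of `a` at ranks from `k` on, or 0 if there are none; the
    -- indicator removes the other ranks from the supremum. Since `a` does not increase with the
    -- rank, the first `k` ranks lie above it.
    pivot : ∀ k → ∃[ θ ] (∀ v → rank v < k → θ ≤ a v) × (∀ v → k ≤ rank v → a v ≤ θ)
    pivot k with supremum (λ v → 𝟙[ k ≤ rank v ] * a v)
    ... | θ , ≤θ , least = θ , above , below
      where
      below : ∀ v → k ≤ rank v → a v ≤ θ
      below v k≤rv = subst (_≤ θ)
        (trans (cong (_* a v) (𝟙-yes k (rank v) k≤rv)) (*-identityˡ (a v))) (≤θ v)

      above : ∀ v → rank v < k → θ ≤ a v
      above v rv<k = least (a v) λ u → case-rank u (k ≤? rank u)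
        where
        case-rank : ∀ u → _ → 𝟙[ k ≤ rank u ] * a u ≤ a v
        case-rank u (yes k≤ru) = ≤-trans (*-monoˡ-≤ (a u) (𝟙≤1 k (rank u)))
          (subst (_≤ a v) (sym (*-identityˡ (a u)))
            (a-mono (rank-≤⇒key-≥ (<⇒≤ (<-≤-trans rv<k k≤ru)))))
        case-rank u (no k≰ru) =
          subst (λ x → x * a u ≤ a v) (sym (𝟙-no k (rank u) (≰⇒> k≰ru))) z≤n

-- The pointwise hypothesis is (y − x)(f − θ) ≥ 0, with the subtractions cleared.
threshold-exchange : ∀ {x y f : Fin n → ℕ} θ →
  (∀ v → x v * f v + y v * θ ≤ y v * f v + x v * θ) → ∑ x ≤ ∑ y →
  ∑ (λ v → x v * f v) ≤ ∑ (λ v → y v * f v)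
threshold-exchange {x = x} {y} {f} θ pointwise ∑x≤∑y = +-cancelʳ-≤ (∑ x * θ) _ _ (begin
  ∑xf + ∑ x * θ                      ≤⟨ +-monoʳ-≤ ∑xf (*-monoˡ-≤ θ ∑x≤∑y) ⟩
  ∑xf + ∑ y * θ                      ≡⟨ cong (∑xf +_) (∑-* θ y) ⟨
  ∑xf + ∑ (λ v → y v * θ)            ≡⟨ ∑-+ (λ v → x v * f v) (λ v → y v * θ) ⟨
  ∑ (λ v → x v * f v + y v * θ)      ≤⟨ ∑-mono pointwise ⟩
  ∑ (λ v → y v * f v + x v * θ)      ≡⟨ ∑-+ (λ v → y v * f v) (λ v → x v * θ) ⟩
  ∑yf + ∑ (λ v → x v * θ)            ≡⟨ cong (∑yf +_) (∑-* θ x) ⟩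
  ∑yf + ∑ x * θ                      ∎)
  where
  open ≤-Reasoning
  ∑xf = ∑ λ v → x v * f v
  ∑yf = ∑ λ v → y v * f v

-- Transportation problems

-- Greedy: the first entry is as large as its upper bound and the lower bounds of the later entries
-- permit.
interpolate : ∀ (l u : Fin n → ℕ) w → (∀ i → l i ≤ u i) → ∑ l ≤ w → w ≤ ∑ u →
  ∃[ c ] (∀ i → l i ≤ c i) × (∀ i → c i ≤ u i) × ∑ c ≡ w
interpolate {zero}  l u w l≤u _ w≤0 = l , (λ ()) , (λ ()) , sym (n≤0⇒n≡0 w≤0)
interpolate {suc n} l u w l≤u ∑l≤w w≤∑u =
    (λ { zero → c₀ ; (suc i) → proj₁ rest i })
  , (λ { zero → ⊓-glb (l≤u zero) (m+n≤o⇒m≤o∸n (l zero) ∑l≤w)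
       ; (suc i) → proj₁ (proj₂ rest) i })
  , (λ { zero → m⊓n≤m (u zero) (w ∸ L) ; (suc i) → proj₁ (proj₂ (proj₂ rest)) i })
  , trans (cong (c₀ +_) (proj₂ (proj₂ (proj₂ rest))))
          (m+[n∸m]≡n (≤-trans (m⊓n≤n (u zero) (w ∸ L)) (m∸n≤m w L)))
  where
  L c₀ : ℕ
  L = ∑ (l ∘ suc)
  c₀ = u zero ⊓ (w ∸ L)

  w∸[w∸L]≡L : w ∸ (w ∸ L) ≡ L
  w∸[w∸L]≡L = m∸[m∸n]≡n (≤-trans (m≤n+m L (l zero)) ∑l≤w)

  w∸c₀≤ : w ∸ c₀ ≤ ∑ (u ∘ suc)
  -- Either the first entry meets its upper bound and the rest inherit `w ≤ ∑ u`, or exactly the sum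
  -- `L` of the remaining lower bounds is left over.
  w∸c₀≤ with ≤-total (u zero) (w ∸ L)
  ... | inj₁ u≤ rewrite m≤n⇒m⊓n≡m u≤ = m≤n+o⇒m∸n≤o w (u zero) w≤∑u
  ... | inj₂ ≤u rewrite m≥n⇒m⊓n≡n ≤u | w∸[w∸L]≡L = ∑-mono (l≤u ∘ suc)

  rest = interpolate (l ∘ suc) (u ∘ suc) (w ∸ c₀) (l≤u ∘ suc)
    (subst (_≤ w ∸ c₀) w∸[w∸L]≡L (∸-monoʳ-≤ w (m⊓n≤n (u zero) (w ∸ L)))) w∸c₀≤

-- Induction on the rows: any first row below `q` with total `p zero` will do, because the remaining
-- row sums still match the reduced column sums.
transport : ∀ {m n} (p : Fin m → ℕ) (q : Fin n → ℕ) → ∑ p ≡ ∑ q →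
  ∃ λ (M : Fin m → Fin n → ℕ) → (∀ i → ∑ (M i) ≡ p i) × (∀ j → ∑ (λ i → M i j) ≡ q j)
transport {zero} p q ∑p≡∑q = (λ ()) , (λ ()) , λ j → sym (∑≡0⇒≡0 q (sym ∑p≡∑q) j)
transport {suc m} {n} p q ∑p≡∑q
  with interpolate (λ _ → 0) q (p zero) (λ _ → z≤n)
         (≤-trans (≤-reflexive (∑-zero {n} λ _ → refl)) z≤n)
         (≤-trans (m≤m+n _ _) (≤-reflexive ∑p≡∑q))
... | c , _ , c≤q , ∑c≡p₀ =
    (λ { zero → c ; (suc i) → proj₁ rest i })
  , (λ { zero → ∑c≡p₀ ; (suc i) → proj₁ (proj₂ rest) i })
  , λ j → trans (cong (c j +_) (proj₂ (proj₂ rest) j)) (m+[n∸m]≡n (c≤q j))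
  where
  open ≡-Reasoning
  rest = transport (p ∘ suc) (λ j → q j ∸ c j) (+-cancelˡ-≡ (p zero) _ _ (begin
    p zero + ∑ (p ∘ suc)         ≡⟨ ∑p≡∑q ⟩
    ∑ q                          ≡⟨ ∑-cong (λ j → m+[n∸m]≡n (c≤q j)) ⟨
    ∑ (λ j → c j + (q j ∸ c j))  ≡⟨ ∑-+ c (λ j → q j ∸ c j) ⟩
    ∑ c + ∑ (λ j → q j ∸ c j)    ≡⟨ cong (_+ ∑ (λ j → q j ∸ c j)) ∑c≡p₀ ⟩
    p zero + ∑ (λ j → q j ∸ c j) ∎))

-- Subsets and flows

χ : Subset n → Fin n → ℕ
χ S v = if lookup S v then 1 else 0

∣∣≡∑χ : (S : Subset n) → ∣ S ∣ ≡ ∑ (χ S)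
∣∣≡∑χ []          = refl
∣∣≡∑χ (true  ∷ S) = cong suc (∣∣≡∑χ S)
∣∣≡∑χ (false ∷ S) = ∣∣≡∑χ S

χ-∈ : ∀ {S : Subset n} {v} → v ∈ S → χ S v ≡ 1
χ-∈ v∈S = cong (if_then 1 else 0) ([]=⇒lookup v∈S)

χ-∉ : ∀ {S : Subset n} {v} → v ∉ S → χ S v ≡ 0
χ-∉ {S = S} {v} v∉S with lookup S v in eq
... | true  = contradiction (lookup⇒[]= v S eq) v∉S
... | false = refl

χ≤1 : ∀ (S : Subset n) v → χ S v ≤ 1
χ≤1 S v with lookup S v
... | true  = ≤-refl
... | false = z≤n

module _ {p} {P : Pred (Fin n) p} (P? : Decidable P) where

  select : Subset n
  select = tabulate (does ∘ P?)

  ∈-select⁺ : ∀ {v} → P v → v ∈ select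
  ∈-select⁺ {v} Pv = lookup⇒[]= v select
    (trans (lookup∘tabulate (does ∘ P?) v) (dec-true (P? v) Pv))

  ∈-select⁻ : ∀ {v} → v ∈ select → P v
  ∈-select⁻ {v} v∈ with P? v | trans (sym (lookup∘tabulate (does ∘ P?) v)) ([]=⇒lookup v∈)
  ... | yes Pv | _ = Pv
  ... | no  _  | ()

module _ {n s : ℕ} (G : Graph n) (D : Subset n) where

  extend-InZ : ∀ (z : Z D G → Fin (suc s)) (f : Fin n → Fin n → ℕ) →
    (∀ x y (xy : InZ D G x y) → toℕ (z (x , y , xy)) ≡ f x y) →
    (∀ x y → ¬ InZ D G x y → f x y ≡ 0) →
    ∀ x y → extend G D z x y ≡ f x y
  extend-InZ z f in-Z off-Z x y with inZ? D G x y
  ... | yes xy = in-Z x y xy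
  ... | no ¬xy = sym (off-Z x y ¬xy)

  extend-outside : ∀ (z : Z D G → Fin (suc s)) x y → ¬ InZ D G x y → extend G D z x y ≡ 0
  extend-outside z x y ¬xy with inZ? D G x y
  ... | yes xy = contradiction xy ¬xy
  ... | no  _  = refl

  extend-mono : ∀ (z z′ : Z D G → Fin (suc s)) → (∀ e → toℕ (z e) ≤ toℕ (z′ e)) →
    ∀ x y → extend G D z x y ≤ extend G D z′ x y
  extend-mono z z′ z≤z′ x y with inZ? D G x y
  ... | yes xy = z≤z′ (x , y , xy)
  ... | no  _  = z≤n

  outflow-outside : ∀ (z : Z D G → Fin (suc s)) {x} → x ∉ D → outflow G D z x ≡ 0
  outflow-outside z {x} x∉D = ∑-zero λ y → extend-outside z x y (x∉D ∘ proj₁)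

  inflow-inside : ∀ (z : Z D G → Fin (suc s)) {y} → y ∈ D → inflow G D z y ≡ 0
  inflow-inside z {y} y∈D = ∑-zero λ x →
    extend-outside z x y λ (_ , y∉D , _) → y∉D y∈D

  outflow-χ : ∀ (z : Z D G → Fin (suc s)) (f : Fin n → ℕ) →
    (∀ x → x ∈ D → outflow G D z x ≡ f x) → ∀ x → outflow G D z x ≡ χ D x * f x
  outflow-χ z f out≡f x = by-cases (x ∈? D)
    where
    by-cases : Dec (x ∈ D) → outflow G D z x ≡ χ D x * f x
    by-cases (yes x∈D) = begin
      outflow G D z x ≡⟨ out≡f x x∈D ⟩
      f x             ≡⟨ *-identityˡ (f x) ⟨
      1 * f x         ≡⟨ cong (_* f x) (χ-∈ x∈D) ⟨
      χ D x * f x     ∎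
      where open ≡-Reasoning
    by-cases (no x∉D) = trans (outflow-outside z x∉D) (cong (_* f x) (sym (χ-∉ x∉D)))

-- Arithmetic inequalities and identities

-- The factors of (y - x)(f - θ) never have opposite signs, as `y` is 1 only where `f` is at least
-- `θ` and 0 only where it is at most `θ`.
exchange-above : ∀ x y f θ → x ≤ 1 → (y ≡ 1 × θ ≤ f) ⊎ (y ≡ 0 × f ≤ θ) →
  x * f + y * θ ≤ y * f + x * θ
exchange-above zero    _ f θ _         (inj₁ (refl , θ≤f)) =
  ≤-trans (+-monoˡ-≤ 0 θ≤f) (m≤m+n _ _)
exchange-above zero    _ f θ _         (inj₂ (refl , _))   = z≤n
exchange-above (suc _) _ f θ (s≤s z≤n) (inj₁ (refl , _))   = ≤-refl
exchange-above (suc _) _ f θ (s≤s z≤n) (inj₂ (refl , f≤θ)) =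
  ≤-trans (≤-reflexive (+-identityʳ (1 * f))) (+-monoˡ-≤ 0 f≤θ)

exchange-below : ∀ x y f θ → x ≤ 1 → (y ≡ 1 × f ≤ θ) ⊎ (y ≡ 0 × θ ≤ f) →
  y * f + x * θ ≤ x * f + y * θ
exchange-below zero    _ f θ _         (inj₁ (refl , f≤θ)) =
  ≤-trans (≤-reflexive (+-identityʳ (1 * f))) (+-monoˡ-≤ 0 f≤θ)
exchange-below zero    _ f θ _         (inj₂ (refl , _))   = z≤n
exchange-below (suc _) _ f θ (s≤s z≤n) (inj₁ (refl , _))   = ≤-refl
exchange-below (suc _) _ f θ (s≤s z≤n) (inj₂ (refl , θ≤f)) =
  ≤-trans (+-monoˡ-≤ 0 θ≤f) (m≤m+n _ _)

m∸[m∸n]≡m⊓n : ∀ m n → m ∸ (m ∸ n) ≡ m ⊓ n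
m∸[m∸n]≡m⊓n m n = begin
  m ∸ (m ∸ n)                      ≡⟨ cong (_∸ (m ∸ n)) (m⊓n+n∸m≡n n m) ⟨
  n ⊓ m + (m ∸ n) ∸ (m ∸ n)        ≡⟨ m+n∸n≡m (n ⊓ m) (m ∸ n) ⟩
  n ⊓ m                            ≡⟨ ⊓-comm n m ⟩
  m ⊓ n                            ∎
  where open ≡-Reasoning

-- Both sides are the maximum of `m` and `n`.
m+[n∸m]≡n+[m∸n] : ∀ m n → m + (n ∸ m) ≡ n + (m ∸ n)
m+[n∸m]≡n+[m∸n] zero    zero    = refl
m+[n∸m]≡n+[m∸n] zero    (suc n) = sym (+-identityʳ (suc n))
m+[n∸m]≡n+[m∸n] (suc m) zero    = +-identityʳ (suc m)
m+[n∸m]≡n+[m∸n] (suc m) (suc n) = cong suc (m+[n∸m]≡n+[m∸n] m n)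

m/o<n⇒m<n*o : ∀ m n o .{{_ : NonZero o}} → m / o < n → m < n * o
m/o<n⇒m<n*o m n o m/o<n = begin-strict
  m                   ≡⟨ m≡m%n+[m/n]*n m o ⟩
  m % o + m / o * o   <⟨ +-monoˡ-< (m / o * o) (m%n<n m o) ⟩
  suc (m / o) * o     ≤⟨ *-monoˡ-≤ o m/o<n ⟩
  n * o               ∎
  where open ≤-Reasoning

-- The combinatorial criterion

module Greedy (n s Δ r T : ℕ) (α : Fin n → ℕ) where

  e : ℕ
  gap surplus eligible key : Fin n → ℕ

  gap v      = T ∸ α v
  surplus v  = α v ∸ T
  eligible v = 𝟙[ gap v ≤ Δ ]
  e          = ∑ eligible
  -- Since toℕ v < n, this orders by α first and breaks ties by index.
  key v      = α v * n + toℕ v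

  key-mono : ∀ {u v} → α u < α v → key u < key v
  key-mono {u} {v} αu<αv = begin-strict
    α u * n + toℕ u  <⟨ +-monoʳ-< (α u * n) (Fin.toℕ<n u) ⟩
    α u * n + n      ≡⟨ +-comm (α u * n) n ⟩
    suc (α u) * n    ≤⟨ *-monoˡ-≤ n αu<αv ⟩
    α v * n          ≤⟨ m≤m+n _ _ ⟩
    key v            ∎
    where open ≤-Reasoning

  α-mono : ∀ {u v} → key u ≤ key v → α u ≤ α v
  α-mono ku≤kv = ≮⇒≥ λ αv<αu → <⇒≱ (key-mono αv<αu) ku≤kv

  key-injective : ∀ {u v} → key u ≡ key v → u ≡ v
  key-injective {u} {v} ku≡kv = Fin.toℕ-injective
    (+-cancelˡ-≡ (α u * n) _ _ (trans ku≡kv (cong (λ a → a * n + toℕ v) (sym αu≡αv))))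
    where
    αu≡αv : α u ≡ α v
    αu≡αv = ≤-antisym (α-mono (≤-reflexive ku≡kv)) (α-mono (≤-reflexive (sym ku≡kv)))

  open Ranking key key-injective public

  top-split : ∀ k v → (top k v ≡ 1 × rank v < k) ⊎ (top k v ≡ 0 × k ≤ rank v)
  top-split k v with rank v <? k
  ... | yes v<k = inj₁ (𝟙-yes (suc (rank v)) k v<k , v<k)
  ... | no  v≮k = inj₂ (𝟙-no (suc (rank v)) k (s≤s (≮⇒≥ v≮k)) , ≮⇒≥ v≮k)

  -- The gap falls as `α` grows, so the pivot `θ` for `α` becomes the threshold `T ∸ θ`, with the
  -- top ranks below it.
  top-gap-least : ∀ k (x : Fin n → ℕ) → (∀ v → x v ≤ 1) → k ≤ n → k ≤ ∑ x →
    ∑ (λ v → top k v * gap v) ≤ ∑ (λ v → x v * gap v)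
  top-gap-least k x x≤1 k≤n k≤∑x with pivot α α-mono k
  ... | θ , above , below = threshold-exchange {x = top k} {x} {gap} (T ∸ θ)
    (λ v → exchange-below (x v) (top k v) (gap v) (T ∸ θ) (x≤1 v) (map
      (λ (top≡1 , v<k) → top≡1 , ∸-monoʳ-≤ T (above v v<k))
      (λ (top≡0 , k≤v) → top≡0 , ∸-monoʳ-≤ T (below v k≤v)) (top-split k v)))
    (subst (_≤ ∑ x) (sym (∑-top k≤n)) k≤∑x)

  top-surplus-greatest : ∀ k (x : Fin n → ℕ) → (∀ v → x v ≤ 1) → k ≤ n → ∑ x ≤ k →
    ∑ (λ v → x v * surplus v) ≤ ∑ (λ v → top k v * surplus v)
  top-surplus-greatest k x x≤1 k≤n ∑x≤k with pivot α α-mono k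
  ... | θ , above , below = threshold-exchange {x = x} {top k} {surplus} (θ ∸ T)
    (λ v → exchange-above (x v) (top k v) (surplus v) (θ ∸ T) (x≤1 v) (map
      (λ (top≡1 , v<k) → top≡1 , ∸-monoˡ-≤ T (above v v<k))
      (λ (top≡0 , k≤v) → top≡0 , ∸-monoˡ-≤ T (below v k≤v)) (top-split k v)))
    (subst (∑ x ≤_) (sym (∑-top k≤n)) ∑x≤k)

  α+gap≡T+surplus : ∀ v → α v + gap v ≡ T + surplus v
  α+gap≡T+surplus v = m+[n∸m]≡n+[m∸n] (α v) T

  -- Adding the gaps of `D` to its supply yields the right-hand side of the covering condition,
  -- taken over `D`; both directions of the equivalence use this.
  ∑-T+surplus : ∀ D → ∑ (λ v → χ D v * α v) + ∑ (λ v → χ D v * gap v)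
                    ≡ ∑ (χ D) * T + ∑ (λ v → χ D v * surplus v)
  ∑-T+surplus D = begin
    ∑ (λ v → χ D v * α v) + ∑ (λ v → χ D v * gap v)
      ≡⟨ ∑-+ (λ v → χ D v * α v) (λ v → χ D v * gap v) ⟨
    ∑ (λ v → χ D v * α v + χ D v * gap v)
      ≡⟨ ∑-cong (λ v → trans (sym (*-distribˡ-+ (χ D v) (α v) (gap v)))
           (trans (cong (χ D v *_) (α+gap≡T+surplus v)) (*-distribˡ-+ (χ D v) T (surplus v)))) ⟩
    ∑ (λ v → χ D v * T + χ D v * surplus v)
      ≡⟨ ∑-+ (λ v → χ D v * T) (λ v → χ D v * surplus v) ⟩
    ∑ (λ v → χ D v * T) + ∑ (λ v → χ D v * surplus v)
      ≡⟨ cong (_+ ∑ (λ v → χ D v * surplus v)) (∑-* T (χ D)) ⟩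
    ∑ (χ D) * T + ∑ (λ v → χ D v * surplus v) ∎
    where open ≡-Reasoning

  -- An ineligible vertex has a positive gap, hence `α v < T` and no surplus.
  eligible-split : ∀ v → (eligible v ≡ 1 × gap v ≤ Δ) ⊎ (eligible v ≡ 0 × surplus v ≡ 0)
  eligible-split v with gap v ≤? Δ
  ... | yes gap≤Δ = inj₁ (𝟙-yes (gap v) Δ gap≤Δ , gap≤Δ)
  ... | no  gap≰Δ = inj₂
    (𝟙-no (gap v) Δ Δ<gap , m≤n⇒m∸n≡0 (<⇒≤ (m∸n≢0⇒n<m {T} {α v} (m<n⇒n≢0 Δ<gap))))
    where Δ<gap = ≰⇒> gap≰Δ

  eligible≤1 : ∀ v → eligible v ≤ 1
  eligible≤1 v = 𝟙≤1 (gap v) Δ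

  -- Were `v` ineligible, every eligible vertex would have a larger `α`, hence precede `v`, and the
  -- rank of `v` would be at least `e`.
  rank<e⇒eligible : ∀ v → rank v < e → gap v ≤ Δ
  rank<e⇒eligible v rank<e = ≮⇒≥ λ Δ<gap →
    <⇒≱ rank<e (∑-mono λ u → by-cases Δ<gap u (eligible-split u))
    where
    by-cases : Δ < gap v → ∀ u → _ → eligible u ≤ 𝟙[ suc (key v) ≤ key u ]
    by-cases Δ<gap u (inj₂ (el≡0 , _))     = ≤-trans (≤-reflexive el≡0) z≤n
    by-cases Δ<gap u (inj₁ (el≡1 , gap≤Δ)) =
      ≤-trans (eligible≤1 u) (≤-reflexive (sym (𝟙-yes (suc (key v)) (key u) kv<ku)))
      where
      kv<ku : key v < key u
      kv<ku = key-mono (≰⇒> λ αu≤αv → <⇒≱ Δ<gap (≤-trans (∸-monoʳ-≤ T αu≤αv) gap≤Δ))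

  -- min (e − r) d; the machine has truncated subtraction but no minimum.
  m : ℕ → ℕ
  m d = (e ∸ r) ∸ (e ∸ r ∸ d)

  m≡⊓ : ∀ d → m d ≡ (e ∸ r) ⊓ d
  m≡⊓ d = m∸[m∸n]≡m⊓n (e ∸ r) d

  m≤d : ∀ d → m d ≤ d
  m≤d d = subst (_≤ d) (sym (m≡⊓ d)) (m⊓n≤n (e ∸ r) d)

  record Criterion (d : ℕ) : Set where
    field
      balanced : d * (s + Δ) ≡ n * Δ
      enough   : r ≤ e
      room     : r + d ≤ n
      covered  : ∑ (λ v → top (r + d) v * gap v) ≤ d * T + ∑ (λ v → top (m d) v * surplus v)

-- Equivalence of the criterion with the existence of a biased dissolution

module _ {n s Δ r T : ℕ} (G : Graph n) (α : Fin n → Fin (suc s))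
         -- `a` will be the copy of `α` read from the input memory, so that the criterion matches
         -- the evaluated term without rewriting.
         (a : Fin n → ℕ) (a≡α : ∀ v → a v ≡ toℕ (α v)) where

  open Greedy n s Δ r T a

  -- Necessity

  module _ (majority⇒T≤ : ∀ x → s + Δ < 2 * x → T ≤ x) (B : BiasedDissolution s Δ r G α) where
    open BiasedDissolution B
    open IsDissolution isDissolution
    open Criterion

    private
      d : ℕ
      d = ∑ (χ D)

      ∑∑-flow : ∀ (z : Z D G → Fin (suc s)) → ∑ (outflow G D z) ≡ ∑ (inflow G D z)
      ∑∑-flow z = ∑-swap (extend G D z)

      d*s : ∑ (outflow G D z) ≡ d * s
      d*s = trans (∑-cong (outflow-χ G D z (λ _ → s) dissolved)) (∑-* s (χ D))

      -- Vertices of `D` receive nothing; crediting each of them with `Δ` makes the total uniform,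
      -- which gives `n * Δ` when summed.
      inflow-balance : ∀ y → inflow G D z y + χ D y * Δ ≡ Δ
      inflow-balance y = by-cases (y ∈? D)
        where
        by-cases : Dec (y ∈ D) → inflow G D z y + χ D y * Δ ≡ Δ
        by-cases (yes y∈D) = cong₂ _+_ (inflow-inside G D z y∈D)
          (trans (cong (_* Δ) (χ-∈ y∈D)) (*-identityˡ Δ))
        by-cases (no y∉D) = trans (cong₂ _+_ (remaining y y∉D) (cong (_* Δ) (χ-∉ y∉D)))
          (+-identityʳ Δ)

      is-balanced : d * (s + Δ) ≡ n * Δ
      is-balanced = begin
        d * (s + Δ)                                ≡⟨ *-distribˡ-+ d s Δ ⟩
        d * s + d * Δ                              ≡⟨ cong₂ _+_ d*s (∑-* Δ (χ D)) ⟨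
        ∑ (outflow G D z) + ∑ (λ y → χ D y * Δ)    ≡⟨ cong (_+ ∑ (λ y → χ D y * Δ)) (∑∑-flow z) ⟩
        ∑ (inflow G D z) + ∑ (λ y → χ D y * Δ)     ≡⟨ ∑-+ (inflow G D z) (λ y → χ D y * Δ) ⟨
        ∑ (λ y → inflow G D z y + χ D y * Δ)       ≡⟨ ∑-cong inflow-balance ⟩
        ∑ {n} (λ _ → Δ)                            ≡⟨ ∑-const n Δ ⟩
        n * Δ                                      ∎
        where open ≡-Reasoning

      received : Fin n → ℕ
      received = inflow G D zα

      ∑-received : ∑ received ≡ ∑ (λ v → χ D v * a v)
      ∑-received = trans (sym (∑∑-flow zα)) (∑-cong
        (outflow-χ G D zα a λ v v∈D → trans (supporters v v∈D) (sym (a≡α v))))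

      R∩D≡∅ : ∀ {v} → v ∈ Rα → v ∉ D
      R∩D≡∅ v∈R v∈D = x∈p⇒x∉∁p v∈D (Rα⊆V∖D v∈R)

      gap≤received : ∀ {v} → v ∈ Rα → gap v ≤ received v
      gap≤received {v} v∈R = m≤n+o⇒m∸n≤o T (a v) (majority⇒T≤ _
        (subst (λ x → s + Δ < 2 * (x + received v)) (sym (a≡α v)) (majority v v∈R)))

      received≤Δ : ∀ {v} → v ∉ D → received v ≤ Δ
      received≤Δ {v} v∉D = subst (received v ≤_) (remaining v v∉D)
        (∑-mono λ x → extend-mono G D zα z bounded x v)

      ∑R≡r : ∑ (χ Rα) ≡ r
      ∑R≡r = trans (sym (∣∣≡∑χ Rα)) ∣Rα∣≡r

      D∪R : Fin n → ℕ
      D∪R v = χ Rα v + χ D v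

      ∑-D∪R : ∑ D∪R ≡ r + d
      ∑-D∪R = trans (∑-+ (χ Rα) (χ D)) (cong (_+ d) ∑R≡r)

      D∪R≤1 : ∀ v → D∪R v ≤ 1
      D∪R≤1 v = by-cases (v ∈? Rα)
        where
        by-cases : Dec (v ∈ Rα) → D∪R v ≤ 1
        by-cases (yes v∈R) = ≤-reflexive (cong₂ _+_ (χ-∈ v∈R) (χ-∉ (R∩D≡∅ v∈R)))
        by-cases (no  v∉R) = ≤-trans (+-monoˡ-≤ (χ D v) (≤-reflexive (χ-∉ v∉R))) (χ≤1 D v)

      has-room : r + d ≤ n
      has-room = begin
        r + d            ≡⟨ ∑-D∪R ⟨
        ∑ D∪R            ≤⟨ ∑-mono D∪R≤1 ⟩
        ∑ {n} (λ _ → 1)  ≡⟨ trans (∑-const n 1) (*-identityʳ n) ⟩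
        n                ∎
        where open ≤-Reasoning

      D∩E : Fin n → ℕ
      D∩E v = χ D v * eligible v

      D∩E≤D : ∀ v → D∩E v ≤ χ D v
      D∩E≤D v = subst (D∩E v ≤_) (*-identityʳ (χ D v)) (*-monoʳ-≤ (χ D v) (eligible≤1 v))

      -- A vertex of `Rα` is eligible because its gap is met by at most `Δ` supporters, and it lies
      -- outside `D`.
      R+D∩E≤E : ∀ v → χ Rα v + D∩E v ≤ eligible v
      R+D∩E≤E v = by-cases (v ∈? Rα)
        where
        by-cases : Dec (v ∈ Rα) → χ Rα v + D∩E v ≤ eligible v
        by-cases (yes v∈R) = ≤-reflexive (trans
          (cong₂ _+_ (χ-∈ v∈R) (cong (_* eligible v) (χ-∉ (R∩D≡∅ v∈R))))
          (sym (𝟙-yes (gap v) Δ (≤-trans (gap≤received v∈R) (received≤Δ (R∩D≡∅ v∈R))))))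
        by-cases (no v∉R) = ≤-trans
          (+-mono-≤ (≤-reflexive (χ-∉ v∉R)) (*-monoˡ-≤ (eligible v) (χ≤1 D v)))
          (≤-reflexive (*-identityˡ (eligible v)))

      r+D∩E≤e : r + ∑ D∩E ≤ e
      r+D∩E≤e = subst (_≤ e) (trans (∑-+ (χ Rα) D∩E) (cong (_+ ∑ D∩E) ∑R≡r)) (∑-mono R+D∩E≤E)

      D∩E≤m : ∑ D∩E ≤ m d
      D∩E≤m = subst (∑ D∩E ≤_) (sym (m≡⊓ d)) (⊓-glb
        (m+n≤o⇒m≤o∸n (∑ D∩E) (subst (_≤ e) (+-comm r (∑ D∩E)) r+D∩E≤e))
        (∑-mono D∩E≤D))

      -- Ineligible vertices carry no surplus, so `D` may be replaced by its eligible part, whose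
      -- size is at most `m d`.
      surplus-eligible : ∀ v → χ D v * surplus v ≡ D∩E v * surplus v
      surplus-eligible v = by-cases (eligible-split v)
        where
        by-cases : _ → χ D v * surplus v ≡ D∩E v * surplus v
        by-cases (inj₁ (el≡1 , _)) = cong (_* surplus v)
          (trans (sym (*-identityʳ (χ D v))) (cong (χ D v *_) (sym el≡1)))
        by-cases (inj₂ (_ , sur≡0)) = trans (trans (cong (χ D v *_) sur≡0) (*-zeroʳ (χ D v)))
          (sym (trans (cong (D∩E v *_) sur≡0) (*-zeroʳ (D∩E v))))

      R-gap≤received : ∀ v → χ Rα v * gap v ≤ received v
      R-gap≤received v = by-cases (v ∈? Rα)
        where
        by-cases : Dec (v ∈ Rα) → χ Rα v * gap v ≤ received v
        by-cases (yes v∈R) = ≤-trans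
          (≤-reflexive (trans (cong (_* gap v) (χ-∈ v∈R)) (*-identityˡ (gap v))))
          (gap≤received v∈R)
        by-cases (no v∉R) = ≤-trans (≤-reflexive (cong (_* gap v) (χ-∉ v∉R))) z≤n

      -- The first and last steps are the two extremal bounds for top segments. In between, the gaps
      -- of `Rα` are bounded by what is received, which equals the supply of `D`.
      is-covered : ∑ (λ v → top (r + d) v * gap v) ≤ d * T + ∑ (λ v → top (m d) v * surplus v)
      is-covered = begin
        ∑ (λ v → top (r + d) v * gap v)
          ≤⟨ top-gap-least (r + d) D∪R D∪R≤1 has-room (≤-reflexive (sym ∑-D∪R)) ⟩
        ∑ (λ v → D∪R v * gap v)
          ≡⟨ ∑-cong (λ v → *-distribʳ-+ (gap v) (χ Rα v) (χ D v)) ⟩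
        ∑ (λ v → χ Rα v * gap v + χ D v * gap v)
          ≡⟨ ∑-+ (λ v → χ Rα v * gap v) (λ v → χ D v * gap v) ⟩
        ∑ (λ v → χ Rα v * gap v) + ∑ (λ v → χ D v * gap v)
          ≤⟨ +-monoˡ-≤ _ (∑-mono R-gap≤received) ⟩
        ∑ received + ∑ (λ v → χ D v * gap v)
          ≡⟨ cong (_+ ∑ (λ v → χ D v * gap v)) ∑-received ⟩
        ∑ (λ v → χ D v * a v) + ∑ (λ v → χ D v * gap v)
          ≡⟨ ∑-T+surplus D ⟩
        d * T + ∑ (λ v → χ D v * surplus v)
          ≡⟨ cong (d * T +_) (∑-cong surplus-eligible) ⟩
        d * T + ∑ (λ v → D∩E v * surplus v)
          ≤⟨ +-monoʳ-≤ (d * T) (top-surplus-greatest (m d) D∩E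
               (λ v → ≤-trans (D∩E≤D v) (χ≤1 D v))
               (≤-trans (m≤d d) (≤-trans (m≤n+m d r) has-room)) D∩E≤m) ⟩
        d * T + ∑ (λ v → top (m d) v * surplus v) ∎
        where open ≤-Reasoning

    necessary : ∃[ d ] Criterion d
    necessary = d , record
      { balanced = is-balanced
      ; enough   = ≤-trans (m≤m+n r (∑ D∩E)) r+D∩E≤e
      ; room     = has-room
      ; covered  = is-covered
      }

  -- Sufficiency

  module _ (T≤⇒majority : ∀ x → T ≤ x → s + Δ < 2 * x) (r>0 : 0 < r)
           (complete : Complete G) {d : ℕ} (criterion : Criterion d) where
    open Criterion criterion

    private
      a≤s : ∀ v → a v ≤ s
      a≤s v = subst (_≤ s) (sym (a≡α v)) (Fin.toℕ≤pred[n] (α v))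

      m₀ : ℕ
      m₀ = m d

      m+r≤e : m₀ + r ≤ e
      m+r≤e = m≤o∸n⇒m+n≤o m₀ enough (m∸n≤m (e ∸ r) (e ∸ r ∸ d))

      m+r≤r+d : m₀ + r ≤ r + d
      m+r≤r+d = subst (_≤ r + d) (+-comm r m₀) (+-monoʳ-≤ r (m≤d d))

      InR InD : Fin n → Set
      InR v = m₀ ≤ rank v × rank v < m₀ + r
      InD v = rank v < m₀ ⊎ (m₀ + r ≤ rank v × rank v < r + d)

      InR? : ∀ v → Dec (InR v)
      InR? v = m₀ ≤? rank v ×-dec rank v <? m₀ + r

      InD? : ∀ v → Dec (InD v)
      InD? v = rank v <? m₀ ⊎-dec (m₀ + r ≤? rank v ×-dec rank v <? r + d)

      D R : Subset n
      D = select InD?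
      R = select InR?

      InR⇒¬InD : ∀ {v} → InR v → ¬ InD v
      InR⇒¬InD (m≤v , _) (inj₁ v<m)         = <⇒≱ v<m m≤v
      InR⇒¬InD (_ , v<m+r) (inj₂ (m+r≤v , _)) = <⇒≱ v<m+r m+r≤v

      χD-yes : ∀ v → InD v → χ D v ≡ 1
      χD-yes v = χ-∈ ∘ ∈-select⁺ InD?

      χD-no : ∀ v → ¬ InD v → χ D v ≡ 0
      χD-no v ¬in = χ-∉ (¬in ∘ ∈-select⁻ InD?)

      χR-yes : ∀ v → InR v → χ R v ≡ 1
      χR-yes v = χ-∈ ∘ ∈-select⁺ InR?

      χR-no : ∀ v → ¬ InR v → χ R v ≡ 0
      χR-no v ¬in = χ-∉ (¬in ∘ ∈-select⁻ InR?)

      top-yes : ∀ k v → rank v < k → top k v ≡ 1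
      top-yes k v = 𝟙-yes (suc (rank v)) k

      top-no : ∀ k v → k ≤ rank v → top k v ≡ 0
      top-no k v k≤v = 𝟙-no (suc (rank v)) k (s≤s k≤v)

      -- The ranks `m₀`, `m₀ + r` and `r + d` cut the vertices into bands on which all indicators
      -- are constant. The second identity serves to count `R`, the first then to count `D`.
      zones : ∀ v → χ R v + χ D v ≡ top (r + d) v × χ R v + top m₀ v ≡ top (m₀ + r) v
      zones v = by-cases (rank v <? m₀) (rank v <? m₀ + r) (rank v <? r + d)
        where
        by-cases : Dec (rank v < m₀) → Dec (rank v < m₀ + r) → Dec (rank v < r + d) →
          χ R v + χ D v ≡ top (r + d) v × χ R v + top m₀ v ≡ top (m₀ + r) v
        by-cases (yes v<m) _ _ =
            trans (cong₂ _+_ R≡0 (χD-yes v (inj₁ v<m)))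
              (sym (top-yes (r + d) v (<-≤-trans v<m+r m+r≤r+d)))
          , trans (cong₂ _+_ R≡0 (top-yes m₀ v v<m)) (sym (top-yes (m₀ + r) v v<m+r))
          where
          v<m+r = <-≤-trans v<m (m≤m+n m₀ r)
          R≡0 = χR-no v (λ (m≤v , _) → <⇒≱ v<m m≤v)
        by-cases (no v≮m) (yes v<m+r) _ =
            trans (cong₂ _+_ R≡1 (χD-no v (InR⇒¬InD inR)))
              (sym (top-yes (r + d) v (<-≤-trans v<m+r m+r≤r+d)))
          , trans (cong₂ _+_ R≡1 (top-no m₀ v (≮⇒≥ v≮m))) (sym (top-yes (m₀ + r) v v<m+r))
          where
          inR = ≮⇒≥ v≮m , v<m+r
          R≡1 = χR-yes v inR
        by-cases (no v≮m) (no v≮m+r) v<r+d? =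
            cong₂ _+_ R≡0 (D≡top v<r+d?)
          , trans (cong₂ _+_ R≡0 (top-no m₀ v (≮⇒≥ v≮m))) (sym (top-no (m₀ + r) v (≮⇒≥ v≮m+r)))
          where
          R≡0 = χR-no v (v≮m+r ∘ proj₂)
          D≡top : Dec (rank v < r + d) → χ D v ≡ top (r + d) v
          D≡top (yes v<r+d) = trans (χD-yes v (inj₂ (≮⇒≥ v≮m+r , v<r+d)))
            (sym (top-yes (r + d) v v<r+d))
          D≡top (no  v≮r+d) = trans
            (χD-no v λ { (inj₁ v<m) → v≮m v<m ; (inj₂ (_ , v<r+d)) → v≮r+d v<r+d })
            (sym (top-no (r + d) v (≮⇒≥ v≮r+d)))

      ∑R≡r : ∑ (χ R) ≡ r
      ∑R≡r = +-cancelʳ-≡ m₀ _ _ (begin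
        ∑ (χ R) + m₀                ≡⟨ cong (∑ (χ R) +_) (∑-top m≤n) ⟨
        ∑ (χ R) + ∑ (top m₀)        ≡⟨ ∑-+ (χ R) (top m₀) ⟨
        ∑ (λ v → χ R v + top m₀ v)  ≡⟨ ∑-cong (proj₂ ∘ zones) ⟩
        ∑ (top (m₀ + r))            ≡⟨ ∑-top m+r≤n ⟩
        m₀ + r                      ≡⟨ +-comm m₀ r ⟩
        r + m₀                      ∎)
        where
        open ≡-Reasoning
        m+r≤n = ≤-trans m+r≤r+d room
        m≤n = ≤-trans (m≤m+n m₀ r) m+r≤n

      ∑D≡d : ∑ (χ D) ≡ d
      ∑D≡d = +-cancelˡ-≡ r _ _ (begin
        r + ∑ (χ D)                ≡⟨ cong (_+ ∑ (χ D)) ∑R≡r ⟨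
        ∑ (χ R) + ∑ (χ D)          ≡⟨ ∑-+ (χ R) (χ D) ⟨
        ∑ (λ v → χ R v + χ D v)    ≡⟨ ∑-cong (proj₁ ∘ zones) ⟩
        ∑ (top (r + d))            ≡⟨ ∑-top room ⟩
        r + d                      ∎)
        where open ≡-Reasoning

      top≤D : ∀ v → top m₀ v ≤ χ D v
      top≤D v = by-cases (top-split m₀ v)
        where
        by-cases : _ → top m₀ v ≤ χ D v
        by-cases (inj₁ (top≡1 , v<m)) = ≤-reflexive (trans top≡1 (sym (χD-yes v (inj₁ v<m))))
        by-cases (inj₂ (top≡0 , _))   = ≤-trans (≤-reflexive top≡0) z≤n

      -- Lower and upper bounds for the supporters a vertex may receive; both vanish on `D`.
      demand capacity : Fin n → ℕ
      demand v   = χ R v * gap v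
      capacity v = (1 ∸ χ D v) * Δ

      supply : ℕ
      supply = ∑ λ v → χ D v * a v

      capacity-∈ : ∀ {v} → v ∈ D → capacity v ≡ 0
      capacity-∈ v∈D = cong (λ x → (1 ∸ x) * Δ) (χ-∈ v∈D)

      capacity-∉ : ∀ {v} → v ∉ D → capacity v ≡ Δ
      capacity-∉ v∉D = trans (cong (λ x → (1 ∸ x) * Δ) (χ-∉ v∉D)) (*-identityˡ Δ)

      demand-∈ : ∀ {v} → v ∈ R → demand v ≡ gap v
      demand-∈ {v} v∈R = trans (cong (_* gap v) (χ-∈ v∈R)) (*-identityˡ (gap v))

      R∩D≡∅ : ∀ {v} → v ∈ R → v ∉ D
      R∩D≡∅ v∈R v∈D = InR⇒¬InD (∈-select⁻ InR? v∈R) (∈-select⁻ InD? v∈D)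

      demand≤capacity : ∀ v → demand v ≤ capacity v
      demand≤capacity v = by-cases (v ∈? R)
        where
        by-cases : Dec (v ∈ R) → demand v ≤ capacity v
        by-cases (yes v∈R) = subst₂ _≤_ (sym (demand-∈ v∈R)) (sym (capacity-∉ (R∩D≡∅ v∈R)))
          -- All ranks in `R` are below `m₀ + r ≤ e`, so the gaps there are at most `Δ`.
          (rank<e⇒eligible v (<-≤-trans (proj₂ (∈-select⁻ InR? v∈R)) m+r≤e))
        by-cases (no v∉R) = ≤-trans (≤-reflexive (cong (_* gap v) (χ-∉ v∉R))) z≤n

      ∑-demand≤supply : ∑ demand ≤ supply
      ∑-demand≤supply = +-cancelʳ-≤ (∑ λ v → χ D v * gap v) _ _ (begin
        ∑ demand + ∑ (λ v → χ D v * gap v)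
          ≡⟨ ∑-+ demand (λ v → χ D v * gap v) ⟨
        ∑ (λ v → demand v + χ D v * gap v)
          ≡⟨ ∑-cong (λ v → trans (sym (*-distribʳ-+ (gap v) (χ R v) (χ D v)))
               (cong (_* gap v) (proj₁ (zones v)))) ⟩
        ∑ (λ v → top (r + d) v * gap v)
          ≤⟨ covered ⟩
        d * T + ∑ (λ v → top m₀ v * surplus v)
          -- `D` contains the first `m₀` ranks, and the surplus of its further vertices can only
          -- help.
          ≤⟨ +-monoʳ-≤ (d * T) (∑-mono λ v → *-monoˡ-≤ (surplus v) (top≤D v)) ⟩
        d * T + ∑ (λ v → χ D v * surplus v)
          ≡⟨ cong (λ x → x * T + ∑ (λ v → χ D v * surplus v)) ∑D≡d ⟨
        ∑ (χ D) * T + ∑ (λ v → χ D v * surplus v)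
          ≡⟨ ∑-T+surplus D ⟨
        supply + ∑ (λ v → χ D v * gap v) ∎)
        where open ≤-Reasoning

      ∑-capacity : ∑ capacity ≡ ∑ (λ v → χ D v * s)
      ∑-capacity = +-cancelʳ-≡ (∑ (χ D) * Δ) _ _ (begin
        ∑ capacity + ∑ (χ D) * Δ               ≡⟨ cong (∑ capacity +_) (∑-* Δ (χ D)) ⟨
        ∑ capacity + ∑ (λ v → χ D v * Δ)       ≡⟨ ∑-+ capacity (λ v → χ D v * Δ) ⟨
        ∑ (λ v → capacity v + χ D v * Δ)       ≡⟨ ∑-cong capacity+D ⟩
        ∑ {n} (λ _ → Δ)                        ≡⟨ ∑-const n Δ ⟩
        n * Δ                                  ≡⟨ balanced ⟨
        d * (s + Δ)                            ≡⟨ cong (_* (s + Δ)) ∑D≡d ⟨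
        ∑ (χ D) * (s + Δ)                      ≡⟨ *-distribˡ-+ (∑ (χ D)) s Δ ⟩
        ∑ (χ D) * s + ∑ (χ D) * Δ              ≡⟨ cong (_+ ∑ (χ D) * Δ) (∑-* s (χ D)) ⟨
        ∑ (λ v → χ D v * s) + ∑ (χ D) * Δ      ∎)
        where
        open ≡-Reasoning
        capacity+D : ∀ v → capacity v + χ D v * Δ ≡ Δ
        capacity+D v = begin
          (1 ∸ χ D v) * Δ + χ D v * Δ  ≡⟨ *-distribʳ-+ Δ (1 ∸ χ D v) (χ D v) ⟨
          (1 ∸ χ D v + χ D v) * Δ      ≡⟨ cong (_* Δ) (m∸n+n≡m (χ≤1 D v)) ⟩
          1 * Δ                        ≡⟨ *-identityˡ Δ ⟩
          Δ                            ∎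

      supply≤∑-capacity : supply ≤ ∑ capacity
      supply≤∑-capacity = subst (supply ≤_) (sym ∑-capacity)
        (∑-mono λ v → *-monoʳ-≤ (χ D v) (a≤s v))

      amounts = interpolate demand capacity supply
        demand≤capacity ∑-demand≤supply supply≤∑-capacity

      received : Fin n → ℕ
      received = proj₁ amounts

      demand≤received : ∀ v → demand v ≤ received v
      demand≤received = proj₁ (proj₂ amounts)

      received≤capacity : ∀ v → received v ≤ capacity v
      received≤capacity = proj₁ (proj₂ (proj₂ amounts))

      ∑-received : ∑ received ≡ supply
      ∑-received = proj₂ (proj₂ (proj₂ amounts))

      -- The non-supporters in each district of `D`; they fill the capacity left by the supporters.
      others : Fin n → ℕ
      others v = χ D v * (s ∸ a v)

      split-s : ∀ v → χ D v * a v + others v ≡ χ D v * s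
      split-s v = trans (sym (*-distribˡ-+ (χ D v) (a v) (s ∸ a v)))
        (cong (χ D v *_) (m+[n∸m]≡n (a≤s v)))

      split-capacity : ∀ v → received v + (capacity v ∸ received v) ≡ capacity v
      split-capacity v = m+[n∸m]≡n (received≤capacity v)

      ∑-others : ∑ others ≡ ∑ (λ v → capacity v ∸ received v)
      ∑-others = +-cancelˡ-≡ supply _ _ (begin
        supply + ∑ others
          ≡⟨ ∑-+ (λ v → χ D v * a v) others ⟨
        ∑ (λ v → χ D v * a v + others v)
          ≡⟨ ∑-cong split-s ⟩
        ∑ (λ v → χ D v * s)
          ≡⟨ ∑-capacity ⟨
        ∑ capacity
          ≡⟨ ∑-cong split-capacity ⟨
        ∑ (λ v → received v + (capacity v ∸ received v))
          ≡⟨ ∑-+ received (λ v → capacity v ∸ received v) ⟩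
        ∑ received + ∑ (λ v → capacity v ∸ received v)
          ≡⟨ cong (_+ ∑ (λ v → capacity v ∸ received v)) ∑-received ⟩
        supply + ∑ (λ v → capacity v ∸ received v) ∎)
        where open ≡-Reasoning

      -- Supporters and others are routed independently and then added, which makes `zα` at most `z`
      -- by construction.
      supporters-plan = transport (λ v → χ D v * a v) received (sym ∑-received)
      others-plan     = transport others (λ v → capacity v ∸ received v) ∑-others

      A O M : Fin n → Fin n → ℕ
      A = proj₁ supporters-plan
      O = proj₁ others-plan
      M x y = A x y + O x y

      M-row : ∀ x → ∑ (M x) ≡ χ D x * s
      M-row x = trans (∑-+ (A x) (O x))
        (trans (cong₂ _+_ (proj₁ (proj₂ supporters-plan) x) (proj₁ (proj₂ others-plan) x))
          (split-s x))

      M-column : ∀ y → ∑ (λ x → M x y) ≡ capacity y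
      M-column y = trans (∑-+ (λ x → A x y) (λ x → O x y))
        (trans (cong₂ _+_ (proj₂ (proj₂ supporters-plan) y) (proj₂ (proj₂ others-plan) y))
          (split-capacity y))

      M≤s : ∀ x y → M x y ≤ s
      M≤s x y = begin
        M x y       ≤⟨ term≤∑ (M x) y ⟩
        ∑ (M x)     ≡⟨ M-row x ⟩
        χ D x * s   ≤⟨ *-monoˡ-≤ s (χ≤1 D x) ⟩
        1 * s       ≡⟨ *-identityˡ s ⟩
        s           ∎
        where open ≤-Reasoning

      A≤M : ∀ x y → A x y ≤ M x y
      A≤M x y = m≤m+n (A x y) (O x y)

      -- Rows outside `D` and columns inside `D` have total zero, so their entries vanish;
      -- completeness puts every remaining pair in `Z D G`.
      M-off : ∀ x y → ¬ InZ D G x y → M x y ≡ 0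
      M-off x y ¬xy = by-cases (x ∈? D) (y ∈? D)
        where
        by-cases : Dec (x ∈ D) → Dec (y ∈ D) → M x y ≡ 0
        by-cases (no x∉D) _ = ∑≡0⇒≡0 (M x) (trans (M-row x) (cong (_* s) (χ-∉ x∉D))) y
        by-cases (yes _) (yes y∈D) = ∑≡0⇒≡0 (λ x → M x y) (trans (M-column y) (capacity-∈ y∈D)) x
        by-cases (yes x∈D) (no y∉D) =
          contradiction (x∈D , y∉D , complete x y λ x≡y → y∉D (subst (_∈ D) x≡y x∈D)) ¬xy

      A-off : ∀ x y → ¬ InZ D G x y → A x y ≡ 0
      A-off x y ¬xy = n≤0⇒n≡0 (subst (A x y ≤_) (M-off x y ¬xy) (A≤M x y))

      z zα : Z D G → Fin (suc s)
      z  (x , y , _) = fromℕ< (s≤s (M≤s x y))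
      zα (x , y , _) = fromℕ< (s≤s (≤-trans (A≤M x y) (M≤s x y)))

      z≡M : ∀ x y → extend G D z x y ≡ M x y
      z≡M = extend-InZ G D z M (λ x y _ → Fin.toℕ-fromℕ< _) M-off

      zα≡A : ∀ x y → extend G D zα x y ≡ A x y
      zα≡A = extend-InZ G D zα A (λ x y _ → Fin.toℕ-fromℕ< _) A-off

      -- If `D` were everything, then `d` would equal `n`, against `r + d ≤ n` with `r` positive.
      ∉D : ∃[ v ] v ∉ D
      ∉D = Fin.¬∀⟶∃¬ n (_∈ D) (_∈? D) λ all∈D → <⇒≱
        (≤-trans (+-monoˡ-≤ d r>0) room)
        (≤-reflexive (trans (sym (trans (∑-const n 1) (*-identityʳ n)))
          (trans (sym (∑-cong λ v → χ-∈ (all∈D v))) ∑D≡d)))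

      received-enough : ∀ v → v ∈ R → T ≤ a v + inflow G D zα v
      received-enough v v∈R = begin
        T                         ≤⟨ m≤n+m∸n T (a v) ⟩
        a v + gap v               ≡⟨ cong (a v +_) (demand-∈ v∈R) ⟨
        a v + demand v            ≤⟨ +-monoʳ-≤ (a v) (demand≤received v) ⟩
        a v + received v          ≡⟨ cong (a v +_) (proj₂ (proj₂ supporters-plan) v) ⟨
        a v + ∑ (λ x → A x v)     ≡⟨ cong (a v +_) (∑-cong (λ x → zα≡A x v)) ⟨
        a v + inflow G D zα v     ∎
        where open ≤-Reasoning

    sufficient : BiasedDissolution s Δ r G α
    sufficient = record
      { D             = D
      ; z             = z
      ; zα            = zα
      ; Rα            = R
      ; isDissolution = record
        { proper    = (λ _ → ∈⊤) , proj₁ ∉D , ∈⊤ , proj₂ ∉D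
        ; dissolved = λ v v∈D → trans (∑-cong (z≡M v)) (trans (M-row v)
            (trans (cong (_* s) (χ-∈ v∈D)) (*-identityˡ s)))
        ; remaining = λ v v∉D → trans (∑-cong λ x → z≡M x v) (trans (M-column v) (capacity-∉ v∉D))
        }
      ; Rα⊆V∖D        = λ v∈R → x∉p⇒x∈∁p (R∩D≡∅ v∈R)
      ; ∣Rα∣≡r        = trans (∣∣≡∑χ R) ∑R≡r
      ; bounded       = λ (x , y , _) → subst₂ _≤_
          (sym (Fin.toℕ-fromℕ< _)) (sym (Fin.toℕ-fromℕ< _)) (A≤M x y)
      ; supporters    = λ v v∈D → trans (∑-cong (zα≡A v)) (trans (proj₁ (proj₂ supporters-plan) v)
          (trans (cong (_* a v) (χ-∈ v∈D)) (trans (*-identityˡ (a v)) (a≡α v))))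
      ; majority      = λ v v∈R → subst (λ x → s + Δ < 2 * (x + inflow G D zα v)) (a≡α v)
          (T≤⇒majority _ (received-enough v v∈R))
      }

-- The summation loop counts downwards and so adds the last summand first.
∑-from-end : ∀ n (F : ℕ → ℕ) → ∑ {suc n} (F ∘ toℕ) ≡ F n + ∑ {n} (F ∘ toℕ)
∑-from-end zero    F = refl
∑-from-end (suc n) F = begin
  F 0 + ∑ {suc n} (F ∘ suc ∘ toℕ)              ≡⟨ cong (F 0 +_) (∑-from-end n (F ∘ suc)) ⟩
  F 0 + (F (suc n) + ∑ {n} (F ∘ suc ∘ toℕ))    ≡⟨ x∙yz≈y∙xz ℕ+ (F 0) (F (suc n)) _ ⟩
  F (suc n) + (F 0 + ∑ {n} (F ∘ suc ∘ toℕ))    ∎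
  where
  open ≡-Reasoning
  ℕ+ = +-commutativeSemigroup

-- Programs evaluating terms with bounded sums

-- Arithmetic terms over the input memory with sums ranging over i < n, where n is
-- the content of cell 0.
data Term (k : ℕ) : Set where
  lit : ℕ → Term k
  var : Fin k → Term k
  mem : Term k → Term k
  op  : Op → Term k → Term k → Term k
  sum : Term (suc k) → Term k

value : (ℕ → ℕ) → Term k → Vector ℕ k → ℕ
value M (lit c)    η = c
value M (var i)    η = η i
value M (mem t)    η = M (value M t η)
value M (op f t u) η = ⟦ f ⟧ (value M t η) (value M u η)
value M (sum t)    η = ∑ {M 0} λ i → value M t (toℕ i Vector.∷ η)

-- Leaves the value of the term in register d, with the variables in the registers
-- ρ i < d and the registers from d on as workspace.
compile : Term k → Vector ℕ k → ℕ → Program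
-- Register `d` accumulates, `suc d` holds the counter and also the summation variable, and the body
-- is evaluated from `2 + d` on.
sum-step sum-loop : Term (suc k) → Vector ℕ k → ℕ → Program

compile (lit c)    ρ d = d := lit c
compile (var i)    ρ d = d := reg (ρ i)
compile (mem t)    ρ d = compile t ρ d ⨾ d := mem (reg d)
compile (op f t u) ρ d =
  compile t ρ d ⨾ compile u ρ (suc d) ⨾ d := op f (reg d) (reg (suc d))
compile (sum t)    ρ d = d := lit 0 ⨾ suc d := mem (lit 0) ⨾ sum-loop t ρ d

sum-step t ρ d =
  -- Decrementing before the body makes the index run from `n − 1` down to 0.
  suc d := op monus (reg (suc d)) (lit 1) ⨾
  compile t (suc d Vector.∷ ρ) (2 + d) ⨾
  d := op add (reg d) (reg (2 + d))

sum-loop t ρ d = whileNZ reg (suc d) loop sum-step t ρ d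

time : ℕ → Term k → ℕ
time n (lit _)    = 2
time n (var _)    = 2
time n (mem t)    = time n t + 3
time n (op _ t u) = time n t + (time n u + 4)
-- The two initialisations cost 2 and 3. Each round spends 2 on the guard and 4 each on decrement
-- and addition; the failing guard costs 2.
time n (sum t)    = 2 + (3 + (n * (10 + time n t) + 2))

update-same : ∀ (f : ℕ → ℕ) i x → (f [ i ↦ x ]) i ≡ x
update-same f i x = cong (if_then x else f i) (dec-true (i ≟ i) refl)

update-other : ∀ (f : ℕ → ℕ) {i j} x → i ≢ j → (f [ i ↦ x ]) j ≡ f j
update-other f {i} {j} x i≢j = cong (if_then x else f j) (dec-false (i ≟ j) i≢j)

-- Preservation of the registers below `d` lets subterms run one after another without losing
-- variables or earlier results.
Computes : Program → State → ℕ → ℕ → ℕ → Set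
Computes P σ b d x = ∃[ t ] ∃[ τ ] ⟨ P , σ ⟩⇓[ t ] τ × t ≤ b
  × regs τ d ≡ x × (∀ j → j < d → regs τ j ≡ regs σ j) × cells τ ≡ cells σ

assign : ∀ d e σ → Computes (d := e) σ (1 + cost e) d (eval e σ)
assign d e σ = _ , _ , set-reg , ≤-refl , update-same (regs σ) d _
  , (λ j j<d → update-other (regs σ) _ (>⇒≢ j<d)) , refl

compile-correct : ∀ (t : Term k) ρ d η σ → (∀ i → ρ i < d) → (∀ i → regs σ (ρ i) ≡ η i) →
  Computes (compile t ρ d) σ (time (cells σ 0) t) d (value (cells σ) t η)

step-correct : ∀ (t : Term (suc k)) ρ d η σ i → (∀ j → ρ j < d) → (∀ j → regs σ (ρ j) ≡ η j) →
  regs σ (suc d) ≡ suc i →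
  ∃[ c ] ∃[ τ ] ⟨ sum-step t ρ d , σ ⟩⇓[ c ] τ × c ≤ 8 + time (cells σ 0) t
    × regs τ d ≡ regs σ d + value (cells σ) t (i Vector.∷ η) × regs τ (suc d) ≡ i
    × (∀ j → j < d → regs τ j ≡ regs σ j) × cells τ ≡ cells σ

-- The accumulator content and the number `i` of remaining rounds are arbitrary, as the induction on
-- `i` requires.
loop-correct : ∀ (t : Term (suc k)) ρ d η σ i → (∀ j → ρ j < d) → (∀ j → regs σ (ρ j) ≡ η j) →
  regs σ (suc d) ≡ i →
  Computes (sum-loop t ρ d) σ (i * (10 + time (cells σ 0) t) + 2) d
    (regs σ d + ∑ {i} λ j → value (cells σ) t (toℕ j Vector.∷ η))

compile-correct (lit c) ρ d η σ ρ<d ρ≡η = assign d (lit c) σ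
compile-correct (var i) ρ d η σ ρ<d ρ≡η with assign d (reg (ρ i)) σ
... | t , τ , run , t≤ , val , rest = t , τ , run , t≤ , trans val (ρ≡η i) , rest
compile-correct (mem t) ρ d η σ ρ<d ρ≡η with compile-correct t ρ d η σ ρ<d ρ≡η
... | _ , τ , run , t≤ , val , frame , cells≡ =
    _ , _ , seq run set-reg , +-monoˡ-≤ 3 t≤
  , trans (update-same (regs τ) d _) (cong₂ (λ M x → M x) cells≡ val)
  , (λ j j<d → trans (update-other (regs τ) _ (>⇒≢ j<d)) (frame j j<d))
  , cells≡
compile-correct (op f t u) ρ d η σ ρ<d ρ≡η
  with compile-correct t ρ d η σ ρ<d ρ≡η
... | _ , ⟪ _ , _ ⟫ , run₁ , t≤₁ , val₁ , frame₁ , refl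
  with compile-correct u ρ (suc d) η _ (m<n⇒m<1+n ∘ ρ<d)
         (λ i → trans (frame₁ (ρ i) (ρ<d i)) (ρ≡η i))
... | _ , τ , run₂ , t≤₂ , val₂ , frame₂ , cells≡ =
    _ , _ , seq run₁ (seq run₂ set-reg) , +-mono-≤ t≤₁ (+-monoˡ-≤ 4 t≤₂)
  , trans (update-same (regs τ) d _)
      (cong₂ ⟦ f ⟧ (trans (frame₂ d ≤-refl) val₁) val₂)
  , (λ j j<d → trans (update-other (regs τ) _ (>⇒≢ j<d))
      (trans (frame₂ j (m<n⇒m<1+n j<d)) (frame₁ j j<d)))
  , cells≡
compile-correct (sum t) ρ d η σ ρ<d ρ≡η = result
  where
  regs₁ regs₂ : ℕ → ℕ
  regs₁ = regs σ [ d ↦ 0 ]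
  regs₂ = regs₁ [ suc d ↦ cells σ 0 ]

  frame₂ : ∀ j → j < d → regs₂ j ≡ regs σ j
  frame₂ j j<d = trans (update-other regs₁ _ (>⇒≢ (m<n⇒m<1+n j<d)))
    (update-other (regs σ) _ (>⇒≢ j<d))

  accumulator₂ : regs₂ d ≡ 0
  accumulator₂ = trans (update-other regs₁ _ 1+n≢n) (update-same (regs σ) d 0)

  result : Computes (compile (sum t) ρ d) σ (time (cells σ 0) (sum t)) d
    (value (cells σ) (sum t) η)
  result with loop-correct t ρ d η ⟪ regs₂ , cells σ ⟫ (cells σ 0) ρ<d
                (λ i → trans (frame₂ (ρ i) (ρ<d i)) (ρ≡η i)) (update-same regs₁ (suc d) _)
  ... | _ , _ , run , c≤ , val , frame , cells≡ =
      _ , _ , seq set-reg (seq set-reg run) , +-monoʳ-≤ 5 c≤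
    , trans val (cong (_+ value (cells σ) (sum t) η) accumulator₂)
    , (λ j j<d → trans (frame j j<d) (frame₂ j j<d)) , cells≡

step-correct t ρ d η σ i ρ<d ρ≡η ≡1+i = result
  where
  regs₁ : ℕ → ℕ
  regs₁ = regs σ [ suc d ↦ regs σ (suc d) ∸ 1 ]

  counter₁ : regs₁ (suc d) ≡ i
  counter₁ = trans (update-same (regs σ) (suc d) _) (cong (_∸ 1) ≡1+i)

  frame₁ : ∀ j → j < suc d → regs₁ j ≡ regs σ j
  frame₁ j j<1+d = update-other (regs σ) _ (>⇒≢ j<1+d)

  result : ∃[ c ] ∃[ τ ] ⟨ sum-step t ρ d , σ ⟩⇓[ c ] τ × c ≤ 8 + time (cells σ 0) t
    × regs τ d ≡ regs σ d + value (cells σ) t (i Vector.∷ η) × regs τ (suc d) ≡ i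
    × (∀ j → j < d → regs τ j ≡ regs σ j) × cells τ ≡ cells σ
  result with compile-correct t (suc d Vector.∷ ρ) (2 + d) (i Vector.∷ η) ⟪ regs₁ , cells σ ⟫
    (λ { zero → ≤-refl ; (suc j) → m<n⇒m<1+n (m<n⇒m<1+n (ρ<d j)) })
    (λ { zero → counter₁ ; (suc j) → trans (frame₁ (ρ j) (m<n⇒m<1+n (ρ<d j))) (ρ≡η j) })
  ... | c , τ , run , c≤ , val , frame , cells≡ =
      _ , _ , seq set-reg (seq run set-reg)
    , subst (4 + (c + 4) ≤_) (cong (4 +_) (+-comm _ 4)) (+-monoʳ-≤ 4 (+-monoˡ-≤ 4 c≤))
    , trans (update-same (regs τ) d _)
        (cong₂ _+_ (trans (frame d (m<n⇒m<1+n ≤-refl)) (frame₁ d ≤-refl)) val)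
    , trans (update-other (regs τ) _ (<⇒≢ ≤-refl)) (trans (frame (suc d) ≤-refl) counter₁)
    , (λ j j<d → trans (update-other (regs τ) _ (>⇒≢ j<d))
        (trans (frame j (m<n⇒m<1+n (m<n⇒m<1+n j<d))) (frame₁ j (m<n⇒m<1+n j<d))))
    , cells≡

loop-correct t ρ d η σ zero ρ<d ρ≡η ≡0 =
  _ , _ , while-zero ≡0 , ≤-refl , sym (+-identityʳ _) , (λ _ _ → refl) , refl
loop-correct t ρ d η σ (suc i) ρ<d ρ≡η ≡1+i
  with step-correct t ρ d η σ i ρ<d ρ≡η ≡1+i
... | c₁ , ⟪ _ , _ ⟫ , run₁ , c₁≤ , val₁ , counter₁ , frame₁ , refl
  with loop-correct t ρ d η _ i ρ<d
         (λ j → trans (frame₁ (ρ j) (ρ<d j)) (ρ≡η j)) counter₁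
... | c₂ , _ , run₂ , c₂≤ , val₂ , frame₂ , cells≡ =
    _ , _
  , while-nonzero (λ ≡0 → 1+n≢0 (trans (sym ≡1+i) ≡0)) run₁ run₂
  , subst (2 + (c₁ + c₂) ≤_) (sym (+-assoc (10 + time (cells σ 0) t) _ 2))
      (+-monoʳ-≤ 2 (+-mono-≤ c₁≤ c₂≤))
  , (begin
      _                                          ≡⟨ val₂ ⟩
      _ + ∑ {i} (F ∘ toℕ)                        ≡⟨ cong (_+ ∑ {i} (F ∘ toℕ)) val₁ ⟩
      regs σ d + F i + ∑ {i} (F ∘ toℕ)           ≡⟨ +-assoc (regs σ d) (F i) _ ⟩
      regs σ d + (F i + ∑ {i} (F ∘ toℕ))         ≡⟨ cong (regs σ d +_) (∑-from-end i F) ⟨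
      regs σ d + ∑ {suc i} (F ∘ toℕ)             ∎)
  , (λ j j<d → trans (frame₂ j j<d) (frame₁ j j<d))
  , cells≡
  where
  open ≡-Reasoning
  F : ℕ → ℕ
  F j = value (cells σ) t (j Vector.∷ η)

-- Polynomial time bounds from the nesting depth of sums

depth coefficient : Term k → ℕ

depth (lit _)    = 0
depth (var _)    = 0
depth (mem t)    = depth t
depth (op _ t u) = depth t ⊔ depth u
depth (sum t)    = suc (depth t)

coefficient (lit _)    = 2
coefficient (var _)    = 2
coefficient (mem t)    = coefficient t + 3
coefficient (op _ t u) = coefficient t + (coefficient u + 4)
coefficient (sum t)    = 10 + coefficient t

-- Powers of `suc n` are at least 1 even for `n = 0`, so they absorb the additive constants at every
-- node.
time≤ : ∀ n (t : Term k) → time n t ≤ coefficient t * suc n ^ depth t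
time≤ n (lit _) = ≤-refl
time≤ n (var _) = ≤-refl
time≤ n (mem t) = begin
  time n t + 3
    ≤⟨ +-mono-≤ (time≤ n t) (m≤m*n 3 p {{m^n≢0 (suc n) (depth t)}}) ⟩
  coefficient t * p + 3 * p
    ≡⟨ *-distribʳ-+ p (coefficient t) 3 ⟨
  (coefficient t + 3) * p ∎
  where
  open ≤-Reasoning
  p = suc n ^ depth t
time≤ n (op f t u) = begin
  time n t + (time n u + 4)
    ≤⟨ +-mono-≤ (raise t (m≤m⊔n (depth t) (depth u)))
         (+-mono-≤ (raise u (m≤n⊔m (depth t) (depth u)))
           (m≤m*n 4 p {{m^n≢0 (suc n) (depth t ⊔ depth u)}})) ⟩
  coefficient t * p + (coefficient u * p + 4 * p)
    ≡⟨ cong (coefficient t * p +_) (*-distribʳ-+ p (coefficient u) 4) ⟨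
  coefficient t * p + (coefficient u + 4) * p
    ≡⟨ *-distribʳ-+ p (coefficient t) (coefficient u + 4) ⟨
  (coefficient t + (coefficient u + 4)) * p ∎
  where
  open ≤-Reasoning
  p = suc n ^ (depth t ⊔ depth u)
  raise : ∀ v → depth v ≤ depth t ⊔ depth u → time n v ≤ coefficient v * p
  raise v v≤ = ≤-trans (time≤ n v) (*-monoʳ-≤ (coefficient v) (^-monoʳ-≤ (suc n) v≤))
time≤ n (sum t) = begin
  5 + (n * (10 + time n t) + 2)       ≡⟨ cong (5 +_) (+-comm (n * (10 + time n t)) 2) ⟩
  -- Of the `suc n` copies on the right, one pays for the overhead 7 and the others for the rounds.
  7 + n * (10 + time n t)             ≤⟨ +-mono-≤ 7≤ (*-monoʳ-≤ n step) ⟩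
  suc n * ((10 + coefficient t) * p)  ≡⟨ *-comm (suc n) ((10 + coefficient t) * p) ⟩
  (10 + coefficient t) * p * suc n    ≡⟨ *-assoc (10 + coefficient t) p (suc n) ⟩
  (10 + coefficient t) * (p * suc n)  ≡⟨ cong ((10 + coefficient t) *_) (*-comm p (suc n)) ⟩
  (10 + coefficient t) * (suc n * p)  ∎
  where
  open ≤-Reasoning
  p = suc n ^ depth t
  step : 10 + time n t ≤ (10 + coefficient t) * p
  step = subst (10 + time n t ≤_) (sym (*-distribʳ-+ p 10 (coefficient t)))
    (+-mono-≤ (m≤m*n 10 p {{m^n≢0 (suc n) (depth t)}}) (time≤ n t))
  7≤ : 7 ≤ (10 + coefficient t) * p
  7≤ = ≤-trans (m≤m+n 7 (3 + time n t)) step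

-- The linear term of the square is at most twice `n ^ 2`. The bound has the shape `c * f I + c`
-- demanded by `SolvableInTimeO`.
[1+n]²≤3n²+3 : ∀ c n → c * suc n ^ 2 ≤ 3 * c * n ^ 2 + 3 * c
[1+n]²≤3n²+3 c n = begin
  c * suc n ^ 2            ≤⟨ *-monoʳ-≤ c (square n) ⟩
  c * (3 * (n ^ 2 + 1))    ≡⟨ regroup c (n ^ 2) ⟩
  3 * c * n ^ 2 + 3 * c    ∎
  where
  open ≤-Reasoning
  regroup : ∀ c x → c * (3 * (x + 1)) ≡ 3 * c * x + 3 * c
  regroup = solve-∀
  expand : ∀ n → suc n * (suc n * 1) ≡ n * (n * 1) + 1 + 2 * n
  expand = solve-∀
  n≤n² : ∀ n → n ≤ n ^ 2
  n≤n² zero    = z≤n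
  n≤n² (suc n) = m≤m*n (suc n) (suc n ^ 1)
  collect : ∀ x → x + 1 + 2 * x + 2 ≡ 3 * (x + 1)
  collect = solve-∀
  square : ∀ n → suc n ^ 2 ≤ 3 * (n ^ 2 + 1)
  square n = begin
    suc n ^ 2                    ≡⟨ expand n ⟩
    n ^ 2 + 1 + 2 * n            ≤⟨ +-monoʳ-≤ (n ^ 2 + 1) (*-monoʳ-≤ 2 (n≤n² n)) ⟩
    n ^ 2 + 1 + 2 * n ^ 2        ≤⟨ m≤m+n _ 2 ⟩
    n ^ 2 + 1 + 2 * n ^ 2 + 2    ≡⟨ collect (n ^ 2) ⟩
    3 * (n ^ 2 + 1)              ∎

time-quadratic : ∀ n (t : Term k) → depth t ≡ 2 →
  time n t ≤ 3 * coefficient t * n ^ 2 + 3 * coefficient t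
time-quadratic n t depth≡2 = ≤-trans (time≤ n t)
  (subst (λ δ → coefficient t * suc n ^ δ ≤ 3 * coefficient t * n ^ 2 + 3 * coefficient t)
    (sym depth≡2) ([1+n]²≤3n²+3 (coefficient t) n))

-- Deciding propositions by zero-one values

private variable
  A B : Set

-- `Answers τ A` is this relation for the content of register 0.
Decides : ℕ → Set → Set
Decides x A = (x ≡ 1 × A) ⊎ (x ≡ 0 × ¬ A)

decides-≤ : ∀ a b → Decides 𝟙[ a ≤ b ] (a ≤ b)
decides-≤ a b with a ≤? b
... | yes a≤b = inj₁ (𝟙-yes a b a≤b , a≤b)
... | no  a≰b = inj₂ (𝟙-no a b (≰⇒> a≰b) , a≰b)

decides-× : ∀ {x y} → Decides x A → Decides y B → Decides (x * y) (A × B)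
decides-× (inj₁ (refl , a)) (inj₁ (refl , b)) = inj₁ (refl , a , b)
decides-× (inj₁ (refl , _)) (inj₂ (refl , ¬b)) = inj₂ (refl , ¬b ∘ proj₂)
decides-× (inj₂ (refl , ¬a)) _ = inj₂ (refl , ¬a ∘ proj₁)

decides-map : ∀ {x} → (A → B) → (B → A) → Decides x A → Decides x B
decides-map f g (inj₁ (x≡1 , a))  = inj₁ (x≡1 , f a)
decides-map f g (inj₂ (x≡0 , ¬a)) = inj₂ (x≡0 , ¬a ∘ g)

-- The criterion as a term

n# s# Δ# r# d# T# e# m# : Term k
n# = mem (lit 0)
s# = mem (lit 1)
Δ# = mem (lit 2)
r# = mem (lit 3)
-- The only candidate for the size of `D`; if the division is inexact, the balance test in `answer`
-- fails.
d# = op div (op mul n# Δ#) (op add s# Δ#)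
T# = op add (lit 1) (op div (op add s# Δ#) (lit 2))

_≤#_ : Term k → Term k → Term k
t ≤# u = op monus (lit 1) (op monus t u)

α# gap# surplus# key# rank# : Fin k → Term k
-- The encoding puts four numbers before the values of `α`.
α# v       = mem (op add (lit 4) (var v))
gap# v     = op monus T# (α# v)
surplus# v = op monus (α# v) T#
key# v     = op add (op mul (α# v) n#) (var v)
rank# v    = sum (op add (lit 1) (key# (suc v)) ≤# key# zero)

top# : Term k → Fin k → Term k
top# t v = op add (lit 1) (rank# v) ≤# t

e# = sum (gap# zero ≤# Δ#)
m# = op monus (op monus e# r#) (op monus (op monus e# r#) d#)

-- A product of the conjuncts of `Criterion`, with the balance equation as two inequalities. Ranks
-- and `e#` are recomputed for each vertex at linear cost, so sums nest only to depth two.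
answer : Term 0
answer = op mul (op mul (d[s+Δ] ≤# nΔ) (nΔ ≤# d[s+Δ]))
  (op mul (r# ≤# e#) (op mul (op add r# d# ≤# n#)
    (sum (op mul (top# (op add r# d#) zero) (gap# zero)) ≤#
     op add (op mul d# T#) (sum (op mul (top# m# zero) (surplus# zero))))))
  where
  d[s+Δ] nΔ : Term 0
  d[s+Δ] = op mul d# (op add s# Δ#)
  nΔ     = op mul n# Δ#

div-exact : ∀ {m} d k → 0 < k → d * k ≡ m → ⟦ div ⟧ m k ≡ d
div-exact d (suc k) _ refl = m*n/n≡m d (suc k)

load-tabulate : ∀ {n} (f : Fin n → ℕ) ys v → load (List.tabulate f List.++ ys) (toℕ v) ≡ f v
load-tabulate f ys zero    = refl
load-tabulate f ys (suc v) = load-tabulate (f ∘ suc) ys v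

-- Correctness of the term and the quadratic bound

module _ (I : Instance) (complete : Complete (Instance.graph I)) where
  open Instance I renaming (n to ∣V∣)

  private
    M : ℕ → ℕ
    M = load (encode I)

    T d : ℕ
    T = suc ((s + Δ) / 2)
    d = ⟦ div ⟧ (∣V∣ * Δ) (s + Δ)

    a : Fin ∣V∣ → ℕ
    a v = M (4 + toℕ v)

    a≡α : ∀ v → a v ≡ toℕ (α v)
    a≡α = load-tabulate (toℕ ∘ α) _

  open Greedy ∣V∣ s Δ r T a

  -- `T` is the least integer whose double exceeds `s + Δ`.
  majority⇒T≤ : ∀ x → s + Δ < 2 * x → T ≤ x
  majority⇒T≤ x s+Δ<2x = m<n*o⇒m/o<n {s + Δ} {x} {2} (subst (s + Δ <_) (*-comm 2 x) s+Δ<2x)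

  T≤⇒majority : ∀ x → T ≤ x → s + Δ < 2 * x
  T≤⇒majority x T≤x = subst (s + Δ <_) (*-comm x 2) (m/o<n⇒m<n*o (s + Δ) x 2 T≤x)

  -- The term evaluates definitionally to the expressions in `Criterion`, so the sides of each
  -- inequality are found by unification.
  answer-decides-criterion : Decides (value M answer (λ ())) (Criterion d)
  answer-decides-criterion = decides-map
    (λ ((≤nΔ , nΔ≤) , r≤e , r+d≤n , cov) → record
      { balanced = ≤-antisym ≤nΔ nΔ≤ ; enough = r≤e ; room = r+d≤n ; covered = cov })
    (λ c → let open Criterion c in
      (≤-reflexive balanced , ≤-reflexive (sym balanced)) , enough , room , covered)
    (decides-× (decides-× (decides-≤ _ _) (decides-≤ _ _))
      (decides-× (decides-≤ _ _) (decides-× (decides-≤ _ _) (decides-≤ _ _))))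

  answer-correct : Decides (value M answer (λ ())) (YesInstance I)
  answer-correct = decides-map
    (sufficient graph α a a≡α T≤⇒majority r>0 complete)
    (λ B → from (necessary graph α a a≡α majority⇒T≤ B))
    answer-decides-criterion
    where
    from : ∃[ d′ ] Criterion d′ → Criterion d
    -- As `s + Δ` is positive, the balance equation forces `d′` to be the computed quotient.
    from (d′ , c) = subst Criterion (sym (div-exact d′ (s + Δ) (≤-trans s>0 (m≤m+n s Δ))
      (Criterion.balanced c))) c

solvable-by-term : ∀ {Q C : Instance → Set} (t : Term 0) → depth t ≡ 2 →
  (∀ I → C I → Decides (value (load (encode I)) t (λ ())) (Q I)) →
  SolvableInTimeO (λ I → Instance.n I ^ 2) Q C
solvable-by-term {Q} {C} t depth≡2 decides = compile t (λ ()) 0 , 3 * coefficient t , decide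
  where
  decide : ∀ I → C I →
    DecidesWithin (3 * coefficient t * Instance.n I ^ 2 + 3 * coefficient t)
      (compile t (λ ()) 0) (encode I) (Q I)
  decide I C-I
    with compile-correct t (λ ()) 0 (λ ()) (initial (encode I)) (λ ()) (λ ())
  ... | c , τ , run , c≤ , val , _ , _ = c , τ , run
    , ≤-trans c≤ (time-quadratic (Instance.n I) t depth≡2)
    , subst (λ x → Decides x (Q I)) (sym val) (decides I C-I)

theorem5 : SolvableInTimeO (λ I → Instance.n I ^ 2)
    YesInstance
    (λ I → Complete (Instance.graph I))
theorem5 = solvable-by-term answer refl answer-correct
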